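{- For real numbers $M_1,M_2\ge 0$ and $N_1,N_2>0$, let $S(M_1,N_1,M_2,N_2)$ be the set of pairs $(A,B)\in\mathbb{Z}^2$ such that $M_1\le|A|\le M_1+N_1$, $M_2\le |B|\le M_2+N_2$, the equation $y^2=x^3+Ax+B$ defines an elliptic curve $E$ over $\mathbb{Q}$, and $E[3](\mathbb{Q})\neq\{0_E\}$. Then: \begin{enumerate} \item There is a constant $C>0$ such that for all sufficiently large $J$, $\#S(0,J^2,0,J^3)\le C J^4$. \item Let $0<b<2$ and $0<c<3$. There is a constant $C>0$ such that for all sufficiently large $J$, \[ \#S(J^2-J^b,\,J^b,\,J^3-J^c,\,J^c)\le C\,J^{\,b+c-\frac{\min(b,c)}{2}} . \] \end{enumerate}
   Context: $E[3](\mathbb{Q})$ denotes the group of $\mathbb{Q}$-rational points of $E$ killed by $3$, and $0_E$ is the identity element. -}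

module Defs where

open import Algebra.Bundles using (module CommutativeRing)
open import Data.Empty using (⊥; ⊥-elim)
open import Data.Integer as ℤ using (ℤ; -[1+_]; _⊖_)
import Data.Integer.Properties as ℤₚ
open import Data.List.Base using (List; length)
open import Data.List.Relation.Unary.All using (All)
open import Data.List.Relation.Unary.Unique.Propositional using (Unique)
open import Data.Nat as ℕ using (ℕ; zero; suc)
import Data.Nat.Properties as ℕₚ
open import Data.Product using (∃-syntax; _×_; _,_)
open import Data.Rational
open import Data.Rational.Properties
open import Data.Rational.Solver using (module +-*-Solver)
import Data.Rational.Unnormalised as ℚᵘ
import Data.Rational.Unnormalised.Properties as ℚᵘₚ
open import Data.Sum using (_⊎_; inj₁; inj₂; [_,_]′; swap)
open import Relation.Binary using (tri<; tri≈; tri>)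
open import Relation.Binary.PropositionalEquality
open import Relation.Nullary using (¬_; Dec; yes; no)
open import Algebra.Properties.CommutativeSemiring.Exp
  (CommutativeRing.commutativeSemiring +-*-commutativeRing)
  using (_^_; ^-homo-*; ^-assocʳ; ^-distrib-*)
open +-*-Solver using (solve; con; _:=_; _:+_; _:*_; _:-_; :-_)

module Rationals where
  ι : ℕ → ℚ
  ι n = ℤ.+ n / 1

  frac : ℕ → ℕ → ℕ → ℚ
  frac m k n = (m ⊖ k) / suc n

  0<1 : 0ℚ < 1ℚ
  0<1 = positive⁻¹ 1ℚ

  <-by : ∀ {p q} d → 0ℚ < d → q ≡ p + d → p < q
  <-by {p} {q} d 0<d eq =
    subst₂ _<_ (+-identityʳ p) (sym eq) (+-monoʳ-< p 0<d)

  ≤-by : ∀ {p q} d → 0ℚ ≤ d → q ≡ p + d → p ≤ q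
  ≤-by {p} {q} d 0≤d eq =
    subst₂ _≤_ (+-identityʳ p) (sym eq) (+-monoʳ-≤ p 0≤d)

  0<- : ∀ {p q} → p < q → 0ℚ < q - p
  0<- {p} {q} p<q = subst (_< q - p) (+-inverseʳ p) (+-monoˡ-< (- p) p<q)

  0≤- : ∀ {p q} → p ≤ q → 0ℚ ≤ q - p
  0≤- {p} {q} p≤q = subst (_≤ q - p) (+-inverseʳ p) (+-monoˡ-≤ (- p) p≤q)

  0<+ : ∀ {p q} → 0ℚ < p → 0ℚ < q → 0ℚ < p + q
  0<+ = +-mono-<

  0≤+ : ∀ {p q} → 0ℚ ≤ p → 0ℚ ≤ q → 0ℚ ≤ p + q
  0≤+ = +-mono-≤

  0<+≤ : ∀ {p q} → 0ℚ < p → 0ℚ ≤ q → 0ℚ < p + q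
  0<+≤ = +-mono-<-≤

  0<* : ∀ {p q} → 0ℚ < p → 0ℚ < q → 0ℚ < p * q
  0<* {p} {q} 0<p 0<q =
    subst (_< p * q) (*-zeroˡ q) (*-monoˡ-<-pos q {{positive 0<q}} 0<p)

  0≤* : ∀ {p q} → 0ℚ ≤ p → 0ℚ ≤ q → 0ℚ ≤ p * q
  0≤* {p} {q} 0≤p 0≤q =
    subst (_≤ p * q) (*-zeroˡ q) (*-monoʳ-≤-nonNeg q {{nonNegative 0≤q}} 0≤p)

  *-mono-≤ˡ : ∀ {p q} r → 0ℚ ≤ r → p ≤ q → r * p ≤ r * q
  *-mono-≤ˡ r 0≤r = *-monoˡ-≤-nonNeg r {{nonNegative 0≤r}}

  *-mono-≤² : ∀ {p q r s} → 0ℚ ≤ r → 0ℚ ≤ q → p ≤ q → r ≤ s → p * r ≤ q * s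
  *-mono-≤² {p} {q} {r} {s} 0≤r 0≤q p≤q r≤s =
    ≤-trans (*-monoʳ-≤-nonNeg r {{nonNegative 0≤r}} p≤q) (*-mono-≤ˡ q 0≤q r≤s)

  *-cancel-≤ : ∀ {p q} r → 0ℚ < r → p * r ≤ q * r → p ≤ q
  *-cancel-≤ r 0<r = *-cancelʳ-≤-pos r {{positive 0<r}}

  *-cancel-< : ∀ {p q} r → 0ℚ < r → p * r < q * r → p < q
  *-cancel-< r 0<r = *-cancelʳ-<-nonNeg r {{nonNegative (<⇒≤ 0<r)}}

  ι-suc : ∀ n → ι (suc n) ≡ 1ℚ + ι n
  ι-suc n = toℚᵘ-injective (ℚᵘₚ.≃-trans (toℚᵘ-fromℚᵘ (ℚᵘ.mkℚᵘ (ℤ.+ suc n) 0))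
    (ℚᵘₚ.≃-sym (ℚᵘₚ.≃-trans (toℚᵘ-homo-+ 1ℚ (ι n))
      (ℚᵘₚ.≃-trans (ℚᵘₚ.+-congʳ (toℚᵘ 1ℚ) (toℚᵘ-fromℚᵘ (ℚᵘ.mkℚᵘ (ℤ.+ n) 0)))
        (ℚᵘ.*≡* (cong (λ z → (ℤ.+ 1 ℤ.+ z) ℤ.* ℤ.+ 1) (ℤₚ.*-identityʳ (ℤ.+ n))))))))

  0≤ι : ∀ n → 0ℚ ≤ ι n
  0≤ι n = nonNegative⁻¹ (ι n) {{normalize-nonNeg n 1}}

  0<ι : ∀ n → 0ℚ < ι (suc n)
  0<ι n = subst (0ℚ <_) (sym (ι-suc n)) (0<+≤ 0<1 (0≤ι n))

  ι-+ : ∀ m n → ι (m ℕ.+ n) ≡ ι m + ι n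
  ι-+ zero n = sym (+-identityˡ (ι n))
  ι-+ (suc m) n = begin
    ι (suc (m ℕ.+ n))    ≡⟨ ι-suc (m ℕ.+ n) ⟩
    1ℚ + ι (m ℕ.+ n)     ≡⟨ cong (1ℚ +_) (ι-+ m n) ⟩
    1ℚ + (ι m + ι n)     ≡⟨ sym (+-assoc 1ℚ (ι m) (ι n)) ⟩
    (1ℚ + ι m) + ι n     ≡⟨ cong (_+ ι n) (sym (ι-suc m)) ⟩
    ι (suc m) + ι n      ∎
    where open ≡-Reasoning

  ι-* : ∀ m n → ι (m ℕ.* n) ≡ ι m * ι n
  ι-* zero n = sym (*-zeroˡ (ι n))
  ι-* (suc m) n = begin
    ι (n ℕ.+ m ℕ.* n)      ≡⟨ ι-+ n (m ℕ.* n) ⟩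
    ι n + ι (m ℕ.* n)      ≡⟨ cong₂ _+_ (sym (*-identityˡ (ι n))) (ι-* m n) ⟩
    1ℚ * ι n + ι m * ι n   ≡⟨ sym (*-distribʳ-+ (ι n) 1ℚ (ι m)) ⟩
    (1ℚ + ι m) * ι n       ≡⟨ cong (_* ι n) (sym (ι-suc m)) ⟩
    ι (suc m) * ι n        ∎
    where open ≡-Reasoning

  ι-mono : ∀ {m n} → m ℕ.≤ n → ι m ≤ ι n
  ι-mono {m} {n} m≤n = ≤-by (ι (n ℕ.∸ m)) (0≤ι (n ℕ.∸ m))
    (trans (cong ι (sym (ℕₚ.m+[n∸m]≡n m≤n))) (ι-+ m (n ℕ.∸ m)))

  ι-cancel-≤ : ∀ {m n} → ι m ≤ ι n → m ℕ.≤ n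
  ι-cancel-≤ {m} {n} ιm≤ιn with m ℕ.≤? n
  ... | yes m≤n = m≤n
  ... | no m≰n = ⊥-elim (<-irrefl refl (<-≤-trans lt ιm≤ιn))
    where
    lt : ι n < ι m
    lt = <-≤-trans (<-by 1ℚ 0<1 (trans (ι-suc n) (+-comm 1ℚ (ι n))))
                   (ι-mono (ℕₚ.≰⇒> m≰n))

  ι-⊖ : ∀ m k → (m ⊖ k) / 1 ≡ ι m - ι k
  ι-⊖ m zero = sym (+-identityʳ (ι m))
  ι-⊖ zero (suc k) = sym (+-identityˡ (- ι (suc k)))
  ι-⊖ (suc m) (suc k) = begin
    (suc m ⊖ suc k) / 1            ≡⟨ cong (_/ 1) (ℤₚ.[1+m]⊖[1+n]≡m⊖n m k) ⟩
    (m ⊖ k) / 1                    ≡⟨ ι-⊖ m k ⟩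
    ι m - ι k                      ≡⟨ solve 2 (λ a b → a :- b := (con 1ℚ :+ a) :- (con 1ℚ :+ b)) refl (ι m) (ι k) ⟩
    (1ℚ + ι m) - (1ℚ + ι k)        ≡⟨ sym (cong₂ _-_ (ι-suc m) (ι-suc k)) ⟩
    ι (suc m) - ι (suc k)          ∎
    where open ≡-Reasoning

  /-* : ∀ i n → (i / suc n) * ι (suc n) ≡ i / 1
  /-* i n = toℚᵘ-injective (ℚᵘₚ.≃-trans (toℚᵘ-homo-* (i / suc n) (ι (suc n)))
    (ℚᵘₚ.≃-trans (ℚᵘₚ.*-cong (toℚᵘ-fromℚᵘ (ℚᵘ.mkℚᵘ i n)) (toℚᵘ-fromℚᵘ (ℚᵘ.mkℚᵘ (ℤ.+ suc n) 0)))
      (ℚᵘₚ.≃-trans (ℚᵘ.*≡* (trans (ℤₚ.*-identityʳ _)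
           (cong (λ z → i ℤ.* z) (cong ℤ.+_ (sym (ℕₚ.*-identityʳ (suc n)))))))
        (ℚᵘₚ.≃-sym (toℚᵘ-fromℚᵘ (ℚᵘ.mkℚᵘ i 0))))))

  frac-* : ∀ m k n → frac m k n * ι (suc n) ≡ ι m - ι k
  frac-* m k n = trans (/-* (m ⊖ k) n) (ι-⊖ m k)

  frac-< : ∀ m k n → frac m k n < frac (suc m) k n
  frac-< m k n = *-cancel-< (ι (suc n)) (0<ι n)
    (subst₂ _<_ (sym (frac-* m k n)) (sym (frac-* (suc m) k n))
      (<-by 1ℚ 0<1 (trans (cong (_- ι k) (ι-suc m))
        (solve 2 (λ a b → (con 1ℚ :+ a) :- b := (a :- b) :+ con 1ℚ) refl (ι m) (ι k)))))

  frac-step : ∀ m k n → frac (suc (suc m)) k n * ι (suc n)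
                      ≡ frac m k n * ι (suc n) + (1ℚ + 1ℚ)
  frac-step m k n = begin
    frac (suc (suc m)) k n * ι (suc n)  ≡⟨ frac-* (suc (suc m)) k n ⟩
    ι (suc (suc m)) - ι k               ≡⟨ cong (_- ι k) (trans (ι-suc (suc m)) (cong (1ℚ +_) (ι-suc m))) ⟩
    (1ℚ + (1ℚ + ι m)) - ι k             ≡⟨ solve 2 (λ a b → (con 1ℚ :+ (con 1ℚ :+ a)) :- b := (a :- b) :+ (con 1ℚ :+ con 1ℚ)) refl (ι m) (ι k) ⟩
    (ι m - ι k) + (1ℚ + 1ℚ)             ≡⟨ cong (_+ (1ℚ + 1ℚ)) (sym (frac-* m k n)) ⟩
    frac m k n * ι (suc n) + (1ℚ + 1ℚ)  ∎
    where open ≡-Reasoning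

  frac-cross : ∀ m k n m′ k′ n′ → frac m k n < frac m′ k′ n′ →
    m ℕ.* suc n′ ℕ.+ k′ ℕ.* suc n ℕ.≤ m′ ℕ.* suc n ℕ.+ k ℕ.* suc n′
  frac-cross m k n m′ k′ n′ lt = ι-cancel-≤
    (subst₂ _≤_ (sym (ι-lin m (suc n′) k′ (suc n))) (sym (ι-lin m′ (suc n) k (suc n′)))
      (≤-by (N * N′ * (r′ - r)) (0≤* (0≤* (0≤ι (suc n)) (0≤ι (suc n′))) (<⇒≤ (0<- lt))) eq))
    where
    N  = ι (suc n)
    N′ = ι (suc n′)
    r  = frac m k n
    r′ = frac m′ k′ n′
    ι-lin : ∀ a b c d → ι (a ℕ.* b ℕ.+ c ℕ.* d) ≡ ι a * ι b + ι c * ι d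
    ι-lin a b c d = trans (ι-+ (a ℕ.* b) (c ℕ.* d)) (cong₂ _+_ (ι-* a b) (ι-* c d))
    eq : ι m′ * N + ι k * N′ ≡ (ι m * N′ + ι k′ * N) + N * N′ * (r′ - r)
    eq = begin
      ι m′ * N + ι k * N′
        ≡⟨ solve 6 (λ m m′ k k′ N N′ → m′ :* N :+ k :* N′ :=
             (m :* N′ :+ k′ :* N) :+ ((m′ :- k′) :* N :- (m :- k) :* N′)) refl
             (ι m) (ι m′) (ι k) (ι k′) N N′ ⟩
      (ι m * N′ + ι k′ * N) + ((ι m′ - ι k′) * N - (ι m - ι k) * N′)
        ≡⟨ cong₂ (λ u v → (ι m * N′ + ι k′ * N) + (u * N - v * N′))
             (sym (frac-* m′ k′ n′)) (sym (frac-* m k n)) ⟩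
      (ι m * N′ + ι k′ * N) + (r′ * N′ * N - r * N * N′)
        ≡⟨ cong ((ι m * N′ + ι k′ * N) +_)
             (solve 4 (λ r r′ N N′ → r′ :* N′ :* N :- r :* N :* N′ := N :* N′ :* (r′ :- r)) refl r r′ N N′) ⟩
      (ι m * N′ + ι k′ * N) + N * N′ * (r′ - r) ∎
      where open ≡-Reasoning

  arch : ∀ q → ∃[ n ] q < ι (suc n)
  arch q@(mkℚ i d _) = ℤ.∣ i ∣ , *-cancel-< D (0<ι d)
      (≤-<-trans (subst (_≤ ι ℤ.∣ i ∣) eq (i≤ i)) (<-≤-trans step step2))
    where
    D = ι (suc d)
    n = ι ℤ.∣ i ∣
    eq : i / 1 ≡ q * D
    eq = trans (sym (/-* i d)) (cong (_* D) (↥p/↧p≡p q))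
    i≤ : ∀ i → i / 1 ≤ ι ℤ.∣ i ∣
    i≤ (ℤ.+ n) = ≤-refl
    i≤ (-[1+ n ]) = ≤-trans (<⇒≤ (neg-antimono-< (0<ι n))) (0≤ι (suc n))
    step : n < ι (suc ℤ.∣ i ∣)
    step = <-by 1ℚ 0<1 (trans (ι-suc ℤ.∣ i ∣) (+-comm 1ℚ n))
    step2 : ι (suc ℤ.∣ i ∣) ≤ ι (suc ℤ.∣ i ∣) * D
    step2 = subst (_≤ ι (suc ℤ.∣ i ∣) * D) (*-identityʳ _)
      (*-mono-≤ˡ (ι (suc ℤ.∣ i ∣)) (0≤ι (suc ℤ.∣ i ∣)) (subst (1ℚ ≤_) (sym (ι-suc d)) (≤-by (ι d) (0≤ι d) refl)))

  arch* : ∀ K ε → 0ℚ < ε → ∃[ n ] K < ε * ι (suc n)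
  arch* K ε 0<ε with arch (K * inv)
    where inv = (1/ ε) {{>-nonZero 0<ε}}
  ... | n , lt = n , subst₂ _<_ e₁ (*-comm (ι (suc n)) ε) (*-monoˡ-<-pos ε {{positive 0<ε}} lt)
    where
    instance _ = >-nonZero 0<ε
    e₁ : K * (1/ ε) * ε ≡ K
    e₁ = trans (*-assoc K (1/ ε) ε) (trans (cong (K *_) (*-inverseˡ ε)) (*-identityʳ K))

  0≤^ : ∀ {x} n → 0ℚ ≤ x → 0ℚ ≤ x ^ n
  0≤^ zero 0≤x = <⇒≤ 0<1
  0≤^ (suc n) 0≤x = 0≤* 0≤x (0≤^ n 0≤x)

  0<^ : ∀ {x} n → 0ℚ < x → 0ℚ < x ^ n
  0<^ zero 0<x = 0<1
  0<^ (suc n) 0<x = 0<* 0<x (0<^ n 0<x)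

  ^-mono : ∀ {x y} n → 0ℚ ≤ x → x ≤ y → x ^ n ≤ y ^ n
  ^-mono zero _ _ = ≤-refl
  ^-mono (suc n) 0≤x x≤y =
    *-mono-≤² (0≤^ n 0≤x) (≤-trans 0≤x x≤y) x≤y (^-mono n 0≤x x≤y)

  ^-monoⁿ : ∀ {x m n} → 1ℚ ≤ x → m ℕ.≤ n → x ^ m ≤ x ^ n
  ^-monoⁿ {x} {m} {n} 1≤x m≤n = subst (λ j → x ^ m ≤ x ^ j) (ℕₚ.m+[n∸m]≡n m≤n)
    (subst₂ _≤_ (*-identityʳ (x ^ m)) (sym (^-homo-* x m (n ℕ.∸ m)))
      (*-mono-≤ˡ (x ^ m) (0≤^ m 0≤x) (1≤^ (n ℕ.∸ m))))
    where
    0≤x = ≤-trans (<⇒≤ 0<1) 1≤x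
    1≤^ : ∀ j → 1ℚ ≤ x ^ j
    1≤^ zero = ≤-refl
    1≤^ (suc j) = subst (_≤ x * x ^ j) (*-identityʳ 1ℚ) (*-mono-≤² (<⇒≤ 0<1) 0≤x 1≤x (1≤^ j))

  ^-cancel : ∀ {x y} n → 0ℚ ≤ x → 0ℚ ≤ y → x ^ suc n ≤ y ^ suc n → x ≤ y
  ^-cancel {x} {y} n 0≤x 0≤y le with x ≤? y
  ... | yes x≤y = x≤y
  ... | no x≰y = ⊥-elim (<-irrefl refl (<-≤-trans lt le))
    where
    y<x = ≰⇒> x≰y
    lt : y ^ suc n < x ^ suc n
    lt = ≤-<-trans (*-mono-≤ˡ y 0≤y (^-mono n 0≤y (<⇒≤ y<x)))
           (*-monoˡ-<-pos (x ^ n) {{positive (0<^ n (≤-<-trans 0≤y y<x))}} y<x)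

  bernoulli : ∀ x y n → 0ℚ ≤ x → 0ℚ ≤ y →
    y ^ n * (y + ι n * (x - y)) ≤ y * x ^ n
  bernoulli x y zero 0≤x 0≤y = ≤-reflexive
    (solve 2 (λ x y → con 1ℚ :* (y :+ con 0ℚ :* (x :- y)) := y :* con 1ℚ) refl x y)
  bernoulli x y (suc n) 0≤x 0≤y = begin
    y * y ^ n * (y + ι (suc n) * (x - y))
      ≡⟨ cong (λ z → y * y ^ n * (y + z * (x - y))) (ι-suc n) ⟩
    y * y ^ n * (y + (1ℚ + ι n) * (x - y))
      ≤⟨ ≤-by (y ^ n * (ι n * ((x - y) * (x - y)))) (0≤* (0≤^ n 0≤y) (0≤* (0≤ι n) sq))
          (solve 4 (λ x y w n → x :* (w :* (y :+ n :* (x :- y))) :=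
             y :* w :* (y :+ (con 1ℚ :+ n) :* (x :- y)) :+ w :* (n :* ((x :- y) :* (x :- y))))
             refl x y (y ^ n) (ι n)) ⟩
    x * (y ^ n * (y + ι n * (x - y)))
      ≤⟨ *-mono-≤ˡ x 0≤x (bernoulli x y n 0≤x 0≤y) ⟩
    x * (y * x ^ n)
      ≡⟨ solve 3 (λ x y v → x :* (y :* v) := y :* (x :* v)) refl x y (x ^ n) ⟩
    y * (x * x ^ n) ∎
    where
    open ≤-Reasoning
    sq : 0ℚ ≤ (x - y) * (x - y)
    sq with ≤-total 0ℚ (x - y)
    ... | inj₁ h = 0≤* h h
    ... | inj₂ h = subst (0ℚ ≤_) (solve 1 (λ d → (:- d) :* (:- d) := d :* d) refl (x - y))
                     (0≤* (neg-antimono-≤ h) (neg-antimono-≤ h))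

  geometric-aux : ∀ K x y n Y X → 0ℚ < y → 0ℚ < Y → K * y < (x - y) * n →
    Y * (y + n * (x - y)) ≤ y * X → K * Y < X
  geometric-aux K x y n Y X 0<y 0<Y lt le = *-cancel-< y 0<y (begin-strict
    K * Y * y               ≡⟨ solve 3 (λ K Y y → K :* Y :* y := Y :* (K :* y)) refl K Y y ⟩
    Y * (K * y)             <⟨ *-monoʳ-<-pos Y {{positive 0<Y}} lt ⟩
    Y * ((x - y) * n)       ≤⟨ *-mono-≤ˡ Y (<⇒≤ 0<Y) (≤-by y (<⇒≤ 0<y)
                                (solve 3 (λ x y n → y :+ n :* (x :- y) := (x :- y) :* n :+ y) refl x y n)) ⟩
    Y * (y + n * (x - y))   ≤⟨ le ⟩
    y * X                   ≡⟨ *-comm y X ⟩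
    X * y                   ∎)
    where open ≤-Reasoning

  geometric : ∀ K {x y} → 0ℚ < y → y < x → ∃[ n ] K * y ^ suc n < x ^ suc n
  geometric K {x} {y} 0<y y<x = let (n , lt) = arch* (K * y) (x - y) (0<- y<x) in
    n , geometric-aux K x y (ι (suc n)) (y ^ suc n) (x ^ suc n) 0<y (0<^ (suc n) 0<y) lt
    (bernoulli x y (suc n) (<⇒≤ (<-trans 0<y y<x)) (<⇒≤ 0<y))

open Rationals

-- Two-sided Dedekind cuts: L x q means q < x and U x q means x < q.
record ℝ : Set₁ where
  field
    L U         : ℚ → Set
    L-inhabited : ∃[ q ] L q
    U-inhabited : ∃[ q ] U q
    L-closed    : ∀ {q r} → q < r → L r → L q
    U-closed    : ∀ {q r} → q < r → U q → U r
    L-open      : ∀ {q} → L q → ∃[ r ] (q < r × L r)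
    U-open      : ∀ {r} → U r → ∃[ q ] (q < r × U q)
    disjoint    : ∀ {q} → L q → U q → ⊥
    located     : ∀ {q r} → q < r → L q ⊎ U r

open ℝ

infix 4 _<ᴿ_ _≤ᴿ_

_<ᴿ_ : ℝ → ℝ → Set
x <ᴿ y = ∃[ q ] (U x q × L y q)

_≤ᴿ_ : ℝ → ℝ → Set
x ≤ᴿ y = ∀ q → L x q → L y q

L<U : ∀ (x : ℝ) {q r} → L x q → U x r → q < r
L<U x {q} {r} Lq Ur with q <? r
... | yes q<r = q<r
... | no  q≮r with ≮⇒≥ q≮r
...   | r≤q with r ≟ q
...     | yes refl = ⊥-elim (disjoint x Lq Ur)
...     | no  r≢q  = ⊥-elim (disjoint x Lq (U-closed x (≤∧≢⇒< r≤q r≢q) Ur))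
  where
  ≤∧≢⇒< : ∀ {p q} → p ≤ q → p ≢ q → p < q
  ≤∧≢⇒< {p} {q} p≤q p≢q with p <? q
  ... | yes p<q = p<q
  ... | no  p≮q = ⊥-elim (p≢q (≤-antisym p≤q (≮⇒≥ p≮q)))

L-max : ∀ (x : ℝ) {a b} → L x a → L x b → ∃[ c ] (a ≤ c × b ≤ c × L x c)
L-max x {a} {b} La Lb with ≤-total a b
... | inj₁ a≤b = b , a≤b , ≤-refl , Lb
... | inj₂ b≤a = a , ≤-refl , b≤a , La

U-min : ∀ (x : ℝ) {a b} → U x a → U x b → ∃[ c ] (c ≤ a × c ≤ b × U x c)
U-min x {a} {b} Ua Ub with ≤-total a b
... | inj₁ a≤b = a , ≤-refl , a≤b , Ua
... | inj₂ b≤a = b , b≤a , ≤-refl , Ub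

grid : ∀ (x : ℝ) n → ∃[ m ] ∃[ k ]
  (L x (frac m k n) × U x (frac (suc (suc m)) k n))
grid x n =
  let (l , Ll) = L-inhabited x
      (u , Uu) = U-inhabited x
      (a , la) = arch (- l)
      (b , ub) = arch u
      k = suc a ℕ.* suc n
      e = suc b ℕ.* suc n ℕ.+ k
      (m , Lm , Um) = search k e 0 (L-closed x (start l a la) Ll)
        (subst (λ j → U x (frac j k n)) (sym (ℕₚ.+-identityʳ e)) (U-closed x (end u b k ub) Uu))
  in m , k , Lm , Um
  where
  N = ι (suc n)
  search : ∀ k d m → L x (frac m k n) → U x (frac (d ℕ.+ m) k n) →
    ∃[ m ] (L x (frac m k n) × U x (frac (suc (suc m)) k n))
  search k zero m Lm Um = ⊥-elim (disjoint x Lm Um)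
  search k (suc d) m Lm Um = [
    (λ L′ → search k d (suc m) L′ (subst (λ j → U x (frac j k n)) (sym (ℕₚ.+-suc d m)) Um)) ,
    (λ U′ → m , Lm , U′) ]′ (located x (frac-< (suc m) k n))
  start : ∀ l a → - l < ι (suc a) → frac 0 (suc a ℕ.* suc n) n < l
  start l a la = *-cancel-< N (0<ι n) (subst (_< l * N) (sym eq) (*-monoˡ-<-pos N {{positive (0<ι n)}} lt))
    where
    A = ι (suc a)
    lt : - A < l
    lt = <-by (A - (- l)) (0<- la) (solve 2 (λ l A → l := (:- A) :+ (A :- (:- l))) refl l A)
    eq : frac 0 (suc a ℕ.* suc n) n * N ≡ - A * N
    eq = trans (frac-* 0 (suc a ℕ.* suc n) n) (trans (cong (λ z → 0ℚ - z) (ι-* (suc a) (suc n)))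
           (solve 2 (λ A N → con 0ℚ :- (A :* N) := (:- A) :* N) refl A N))
  end : ∀ u b k → u < ι (suc b) → u < frac (suc b ℕ.* suc n ℕ.+ k) k n
  end u b k ub = *-cancel-< N (0<ι n) (subst (u * N <_) (sym eq) (*-monoˡ-<-pos N {{positive (0<ι n)}} ub))
    where
    B = ι (suc b)
    eq : frac (suc b ℕ.* suc n ℕ.+ k) k n * N ≡ B * N
    eq = trans (frac-* (suc b ℕ.* suc n ℕ.+ k) k n)
      (trans (cong (_- ι k) (trans (ι-+ (suc b ℕ.* suc n) k) (cong (_+ ι k) (ι-* (suc b) (suc n)))))
        (solve 3 (λ B N k → (B :* N :+ k) :- k := B :* N) refl B N (ι k)))

approx : ∀ (x : ℝ) ε → 0ℚ < ε → ∃[ a ] ∃[ b ] (L x a × U x b × b < a + ε)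
approx x ε 0<ε =
  let (n , lt) = arch* (1ℚ + 1ℚ) ε 0<ε
      (m , k , Lm , Um) = grid x n
  in frac m k n , frac (suc (suc m)) k n , Lm , Um , close n m k lt
  where
  close : ∀ n m k → 1ℚ + 1ℚ < ε * ι (suc n) → frac (suc (suc m)) k n < frac m k n + ε
  close n m k lt = *-cancel-< N (0<ι n) (subst₂ _<_ (sym (frac-step m k n))
      (sym (*-distribʳ-+ N (frac m k n) ε)) (+-monoʳ-< (frac m k n * N) lt))
    where N = ι (suc n)

approxIn : ∀ (x : ℝ) {a₀ b₀} ε → 0ℚ < ε → L x a₀ → U x b₀ →
  ∃[ a ] ∃[ b ] (L x a × U x b × a₀ ≤ a × b ≤ b₀ × b < a + ε)
approxIn x ε 0<ε La₀ Ub₀ =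
  let (a , b , La , Ub , lt) = approx x ε 0<ε
      (a′ , a₀≤a′ , a≤a′ , La′) = L-max x La₀ La
      (b′ , b′≤b₀ , b′≤b , Ub′) = U-min x Ub₀ Ub
  in a′ , b′ , La′ , Ub′ , a₀≤a′ , b′≤b₀ ,
     ≤-<-trans b′≤b (<-≤-trans lt (+-monoˡ-≤ ε a≤a′))

fromℚ : ℚ → ℝ
fromℚ q = record
  { L           = _< q
  ; U           = q <_
  ; L-inhabited = q - 1ℚ , <-by 1ℚ 0<1 (solve 1 (λ q → q := (q :- con 1ℚ) :+ con 1ℚ) refl q)
  ; U-inhabited = q + 1ℚ , <-by 1ℚ 0<1 refl
  ; L-closed    = <-trans
  ; U-closed    = λ r<s q<r → <-trans q<r r<s
  ; L-open      = <-dense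
  ; U-open      = λ q<r → let (s , q<s , s<r) = <-dense q<r in s , s<r , q<s
  ; disjoint    = <-asym
  ; located     = loc
  }
  where
  loc : ∀ {r s} → r < s → r < q ⊎ q < s
  loc {r} {s} r<s with r <? q
  ... | yes r<q = inj₁ r<q
  ... | no  r≮q = inj₂ (≤-<-trans (≮⇒≥ r≮q) r<s)

infix  8 -ᴿ_

infixl 6 _+ᴿ_ _-ᴿ_

-ᴿ_ : ℝ → ℝ
-ᴿ x = record
  { L           = λ q → U x (- q)
  ; U           = λ q → L x (- q)
  ; L-inhabited = let (u , Uu) = U-inhabited x in - u , subst (U x) (sym (neg² u)) Uu
  ; U-inhabited = let (l , Ll) = L-inhabited x in - l , subst (L x) (sym (neg² l)) Ll
  ; L-closed    = λ q<r → U-closed x (neg-antimono-< q<r)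
  ; U-closed    = λ q<r → L-closed x (neg-antimono-< q<r)
  ; L-open      = λ {q} h → let (r , r<-q , Ur) = U-open x h in
                    - r , subst (_< - r) (neg² q) (neg-antimono-< r<-q) , subst (U x) (sym (neg² r)) Ur
  ; U-open      = λ {q} h → let (r , -q<r , Lr) = L-open x h in
                    - r , subst (- r <_) (neg² q) (neg-antimono-< -q<r) , subst (L x) (sym (neg² r)) Lr
  ; disjoint    = λ u l → disjoint x l u
  ; located     = λ q<r → swap (located x (neg-antimono-< q<r))
  }
  where
  neg² : ∀ q → - (- q) ≡ q
  neg² = solve 1 (λ q → :- (:- q) := q) refl

_+ᴿ_ : ℝ → ℝ → ℝ
x +ᴿ y = record
  { L           = λ q → ∃[ a ] ∃[ b ] (L x a × L y b × q < a + b)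
  ; U           = λ q → ∃[ a ] ∃[ b ] (U x a × U y b × a + b < q)
  ; L-inhabited = let (a , La) = L-inhabited x ; (b , Lb) = L-inhabited y in
                    a + b - 1ℚ , a , b , La , Lb ,
                    <-by 1ℚ 0<1 (solve 1 (λ q → q := (q :- con 1ℚ) :+ con 1ℚ) refl (a + b))
  ; U-inhabited = let (a , Ua) = U-inhabited x ; (b , Ub) = U-inhabited y in
                    a + b + 1ℚ , a , b , Ua , Ub , <-by 1ℚ 0<1 refl
  ; L-closed    = λ { q<r (a , b , La , Lb , r<) → a , b , La , Lb , <-trans q<r r< }
  ; U-closed    = λ { q<r (a , b , Ua , Ub , <q) → a , b , Ua , Ub , <-trans <q q<r }
  ; L-open      = λ { (a , b , La , Lb , q<) → let (r , q<r , r<) = <-dense q< in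
                      r , q<r , a , b , La , Lb , r< }
  ; U-open      = λ { (a , b , Ua , Ub , <q) → let (r , <r , r<q) = <-dense <q in
                      r , r<q , a , b , Ua , Ub , <r }
  ; disjoint    = λ { (a , b , La , Lb , q<) (a′ , b′ , Ua , Ub , <q) →
                      <-asym (<-trans q< (+-mono-< (L<U x La Ua) (L<U y Lb Ub))) <q }
  ; located     = loc
  }
  where
  loc : ∀ {q p} → q < p → (∃[ a ] ∃[ b ] (L x a × L y b × q < a + b))
                        ⊎ (∃[ a ] ∃[ b ] (U x a × U y b × a + b < p))
  loc {q} {p} q<p =
    let (a , a′ , La , Ua , ha) = approx x ε 0<ε
        (b , b′ , Lb , Ub , hb) = approx y ε 0<ε
    in decide a a′ b b′ La Ua Lb Ub ha hb
    where
    ε = (p - q) * ½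
    0<ε = 0<* (0<- q<p) (positive⁻¹ ½)
    decide : ∀ a a′ b b′ → L x a → U x a′ → L y b → U y b′ → a′ < a + ε → b′ < b + ε → _
    decide a a′ b b′ La Ua Lb Ub ha hb with q <? a + b
    ... | yes q< = inj₁ (a , b , La , Lb , q<)
    ... | no  q≮ = inj₂ (a′ , b′ , Ua , Ub , (begin-strict
      a′ + b′              <⟨ +-mono-< ha hb ⟩
      (a + ε) + (b + ε)    ≡⟨ solve 4 (λ a b p q → (a :+ (p :- q) :* con ½) :+ (b :+ (p :- q) :* con ½)
                                := (a :+ b) :+ (p :- q)) refl a b p q ⟩
      (a + b) + (p - q)    ≤⟨ +-monoˡ-≤ (p - q) (≮⇒≥ q≮) ⟩
      q + (p - q)          ≡⟨ solve 2 (λ p q → q :+ (p :- q) := p) refl p q ⟩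
      p                    ∎))
      where open ≤-Reasoning

_-ᴿ_ : ℝ → ℝ → ℝ
x -ᴿ y = x +ᴿ (-ᴿ y)

min : ℝ → ℝ → ℝ
min x y = record
  { L           = λ q → L x q × L y q
  ; U           = λ q → U x q ⊎ U y q
  ; L-inhabited = inh
  ; U-inhabited = let (u , Uu) = U-inhabited x in u , inj₁ Uu
  ; L-closed    = λ { q<r (Lx , Ly) → L-closed x q<r Lx , L-closed y q<r Ly }
  ; U-closed    = λ { q<r (inj₁ Ux) → inj₁ (U-closed x q<r Ux)
                    ; q<r (inj₂ Uy) → inj₂ (U-closed y q<r Uy) }
  ; L-open      = lopen
  ; U-open      = λ { (inj₁ Ux) → let (r , r<q , Ur) = U-open x Ux in r , r<q , inj₁ Ur
                    ; (inj₂ Uy) → let (r , r<q , Ur) = U-open y Uy in r , r<q , inj₂ Ur }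
  ; disjoint    = λ { (Lx , Ly) (inj₁ Ux) → disjoint x Lx Ux
                    ; (Lx , Ly) (inj₂ Uy) → disjoint y Ly Uy }
  ; located     = loc
  }
  where
  inh : ∃[ q ] (L x q × L y q)
  inh with L-inhabited x | L-inhabited y
  ... | a , La | b , Lb with <-cmp a b
  ...   | tri< a<b _ _  = a , La , L-closed y a<b Lb
  ...   | tri≈ _ refl _ = a , La , Lb
  ...   | tri> _ _ b<a  = b , L-closed x b<a La , Lb
  lopen : ∀ {q} → L x q × L y q → ∃[ r ] (q < r × L x r × L y r)
  lopen (Lx , Ly) with L-open x Lx | L-open y Ly
  ... | a , q<a , La | b , q<b , Lb with <-cmp a b
  ...   | tri< a<b _ _  = a , q<a , La , L-closed y a<b Lb
  ...   | tri≈ _ refl _ = a , q<a , La , Lb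
  ...   | tri> _ _ b<a  = b , q<b , L-closed x b<a La , Lb
  loc : ∀ {q r} → q < r → (L x q × L y q) ⊎ (U x r ⊎ U y r)
  loc q<r with located x q<r | located y q<r
  ... | inj₁ Lx | inj₁ Ly = inj₁ (Lx , Ly)
  ... | inj₂ Ux | _       = inj₂ (inj₁ Ux)
  ... | _       | inj₂ Uy = inj₂ (inj₂ Uy)

-- Least and greatest value of z * w for z between a, a′ and w between b, b′.
lo hi : ℚ → ℚ → ℚ → ℚ → ℚ
lo a a′ b b′ = ((a * b) ⊓ (a * b′)) ⊓ ((a′ * b) ⊓ (a′ * b′))
hi a a′ b b′ = ((a * b) ⊔ (a * b′)) ⊔ ((a′ * b) ⊔ (a′ * b′))

module Products where

  mid-lo : ∀ {a z a′} c → a ≤ z → z ≤ a′ → (a * c) ⊓ (a′ * c) ≤ z * c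
  mid-lo {a} {z} {a′} c a≤z z≤a′ with ≤-total 0ℚ c
  ... | inj₁ 0≤c = ≤-trans (p⊓q≤p (a * c) (a′ * c)) (*-monoʳ-≤-nonNeg c {{nonNegative 0≤c}} a≤z)
  ... | inj₂ c≤0 = ≤-trans (p⊓q≤q (a * c) (a′ * c)) (*-monoʳ-≤-nonPos c {{nonPositive c≤0}} z≤a′)

  mid-hi : ∀ {a z a′} c → a ≤ z → z ≤ a′ → z * c ≤ (a * c) ⊔ (a′ * c)
  mid-hi {a} {z} {a′} c a≤z z≤a′ with ≤-total 0ℚ c
  ... | inj₁ 0≤c = ≤-trans (*-monoʳ-≤-nonNeg c {{nonNegative 0≤c}} z≤a′) (p≤q⊔p (a * c) (a′ * c))
  ... | inj₂ c≤0 = ≤-trans (*-monoʳ-≤-nonPos c {{nonPositive c≤0}} a≤z) (p≤p⊔q (a * c) (a′ * c))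

  lo≤ : ∀ {a z a′ b w b′} → a ≤ z → z ≤ a′ → b ≤ w → w ≤ b′ → lo a a′ b b′ ≤ z * w
  lo≤ {a} {z} {a′} {b} {w} {b′} a≤z z≤a′ b≤w w≤b′ = begin
    ((a * b) ⊓ (a * b′)) ⊓ ((a′ * b) ⊓ (a′ * b′))
      ≤⟨ ⊓-glb
          (⊓-glb (≤-trans (p⊓q≤p p q) (p⊓q≤p (a * b) (a * b′))) (≤-trans (p⊓q≤q p q) (p⊓q≤p (a′ * b) (a′ * b′))))
          (⊓-glb (≤-trans (p⊓q≤p p q) (p⊓q≤q (a * b) (a * b′))) (≤-trans (p⊓q≤q p q) (p⊓q≤q (a′ * b) (a′ * b′)))) ⟩
    ((a * b) ⊓ (a′ * b)) ⊓ ((a * b′) ⊓ (a′ * b′))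
      ≤⟨ ⊓-mono-≤ (mid-lo b a≤z z≤a′) (mid-lo b′ a≤z z≤a′) ⟩
    (z * b) ⊓ (z * b′)  ≡⟨ cong₂ _⊓_ (*-comm z b) (*-comm z b′) ⟩
    (b * z) ⊓ (b′ * z)  ≤⟨ mid-lo z b≤w w≤b′ ⟩
    w * z               ≡⟨ *-comm w z ⟩
    z * w               ∎
    where
    open ≤-Reasoning
    p = (a * b) ⊓ (a * b′)
    q = (a′ * b) ⊓ (a′ * b′)

  ≤hi : ∀ {a z a′ b w b′} → a ≤ z → z ≤ a′ → b ≤ w → w ≤ b′ → z * w ≤ hi a a′ b b′
  ≤hi {a} {z} {a′} {b} {w} {b′} a≤z z≤a′ b≤w w≤b′ = begin
    z * w               ≡⟨ *-comm z w ⟩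
    w * z               ≤⟨ mid-hi z b≤w w≤b′ ⟩
    (b * z) ⊔ (b′ * z)  ≡⟨ cong₂ _⊔_ (*-comm b z) (*-comm b′ z) ⟩
    (z * b) ⊔ (z * b′)  ≤⟨ ⊔-mono-≤ (mid-hi b a≤z z≤a′) (mid-hi b′ a≤z z≤a′) ⟩
    ((a * b) ⊔ (a′ * b)) ⊔ ((a * b′) ⊔ (a′ * b′))
      ≤⟨ ⊔-lub
          (⊔-lub (≤-trans (p≤p⊔q (a * b) (a * b′)) (p≤p⊔q p q)) (≤-trans (p≤p⊔q (a′ * b) (a′ * b′)) (p≤q⊔p p q)))
          (⊔-lub (≤-trans (p≤q⊔p (a * b) (a * b′)) (p≤p⊔q p q)) (≤-trans (p≤q⊔p (a′ * b) (a′ * b′)) (p≤q⊔p p q))) ⟩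
    ((a * b) ⊔ (a * b′)) ⊔ ((a′ * b) ⊔ (a′ * b′)) ∎
    where
    open ≤-Reasoning
    p = (a * b) ⊔ (a * b′)
    q = (a′ * b) ⊔ (a′ * b′)

  shrink : ∀ K e → 0ℚ < e → ∃[ δ ] (0ℚ < δ × K * δ ≤ e)
  shrink K e 0<e = let (n , K<) = arch K in e * frac 1 0 n , 0<* 0<e (f>0 n) , le n K<
    where
    f-inv : ∀ n → frac 1 0 n * ι (suc n) ≡ 1ℚ
    f-inv n = frac-* 1 0 n
    f>0 : ∀ n → 0ℚ < frac 1 0 n
    f>0 n = *-cancel-< (ι (suc n)) (0<ι n)
      (subst₂ _<_ (sym (*-zeroˡ (ι (suc n)))) (sym (f-inv n)) 0<1)
    le : ∀ n → K < ι (suc n) → K * (e * frac 1 0 n) ≤ e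
    le n K< = begin
      K * (e * f)          ≤⟨ *-monoʳ-≤-nonNeg (e * f) {{nonNegative (<⇒≤ (0<* 0<e (f>0 n)))}} (<⇒≤ K<) ⟩
      N * (e * f)          ≡⟨ solve 3 (λ N e f → N :* (e :* f) := e :* (f :* N)) refl N e f ⟩
      e * (f * N)          ≡⟨ cong (e *_) (f-inv n) ⟩
      e * 1ℚ               ≡⟨ *-identityʳ e ⟩
      e                    ∎
      where
      open ≤-Reasoning
      N = ι (suc n)
      f = frac 1 0 n

  term≤ : ∀ {K u k δ} → u ≤ K → 0ℚ ≤ K → 0ℚ ≤ k → k ≤ δ → u * k ≤ K * δ
  term≤ {K} {u} {k} u≤K 0≤K 0≤k k≤δ = *-mono-≤² 0≤k 0≤K u≤K k≤δ

  corners : ∀ {K δ e a a′ b b′} → 0ℚ < K → K * δ + K * δ ≤ e →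
    - a ≤ K → a ≤ K → - b ≤ K → b ≤ K → - b′ ≤ K → b′ ≤ K →
    a ≤ a′ → a′ - a ≤ δ → b ≤ b′ → b′ - b ≤ δ →
    (a * b - e ≤ lo a a′ b b′) × (hi a a′ b b′ ≤ a * b + e)
  corners {K} {δ} {e} {a} {a′} {b} {b′} 0<K 2E≤e -a≤ a≤ -b≤ b≤ -b′≤ b′≤ a≤a′ ha b≤b′ hb =
      ⊓-glb (⊓-glb (low z₀ 0≤2E 0≤2E) (low z₁ (up₁) (dn₁)))
            (⊓-glb (low z₂ up₂ dn₂) (low z₃ up₃ dn₃))
    , ⊔-lub (⊔-lub (high z₀ 0≤2E 0≤2E) (high z₁ up₁ dn₁))
            (⊔-lub (high z₂ up₂ dn₂) (high z₃ up₃ dn₃))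
    where
    h = a′ - a
    k = b′ - b
    E = K * δ
    0≤K = <⇒≤ 0<K
    0≤h = 0≤- a≤a′
    0≤k = 0≤- b≤b′
    0≤E : 0ℚ ≤ E
    0≤E = 0≤* 0≤K (≤-trans 0≤h ha)
    0≤2E : 0ℚ ≤ E + E
    0≤2E = 0≤+ 0≤E 0≤E
    neg* : ∀ u v → - (u * v) ≡ (- u) * v
    neg* u v = solve 2 (λ u v → :- (u :* v) := (:- u) :* v) refl u v
    E≤2E : E ≤ E + E
    E≤2E = ≤-by E 0≤E refl
    z₀ : a * b ≡ a * b + 0ℚ
    z₀ = sym (+-identityʳ (a * b))
    z₁ : a * b′ ≡ a * b + a * k
    z₁ = solve 3 (λ a b b′ → a :* b′ := a :* b :+ a :* (b′ :- b)) refl a b b′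
    z₂ : a′ * b ≡ a * b + b * h
    z₂ = solve 3 (λ a a′ b → a′ :* b := a :* b :+ b :* (a′ :- a)) refl a a′ b
    z₃ : a′ * b′ ≡ a * b + (a * k + b′ * h)
    z₃ = solve 4 (λ a a′ b b′ → a′ :* b′ := a :* b :+ (a :* (b′ :- b) :+ b′ :* (a′ :- a))) refl a a′ b b′
    up₁ : a * k ≤ E + E
    up₁ = ≤-trans (term≤ a≤ 0≤K 0≤k hb) E≤2E
    dn₁ : - (a * k) ≤ E + E
    dn₁ = ≤-trans (subst (_≤ E) (sym (neg* a k)) (term≤ -a≤ 0≤K 0≤k hb)) E≤2E
    up₂ : b * h ≤ E + E
    up₂ = ≤-trans (term≤ b≤ 0≤K 0≤h ha) E≤2E
    dn₂ : - (b * h) ≤ E + E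
    dn₂ = ≤-trans (subst (_≤ E) (sym (neg* b h)) (term≤ -b≤ 0≤K 0≤h ha)) E≤2E
    up₃ : a * k + b′ * h ≤ E + E
    up₃ = +-mono-≤ (term≤ a≤ 0≤K 0≤k hb) (term≤ b′≤ 0≤K 0≤h ha)
    dn₃ : - (a * k + b′ * h) ≤ E + E
    dn₃ = subst (_≤ E + E) (solve 4 (λ a k b h → (:- a) :* k :+ (:- b) :* h := :- (a :* k :+ b :* h)) refl a k b′ h)
      (+-mono-≤ (term≤ -a≤ 0≤K 0≤k hb) (term≤ -b′≤ 0≤K 0≤h ha))
    low : ∀ {c t} → c ≡ a * b + t → t ≤ E + E → - t ≤ E + E → a * b - e ≤ c
    low {c} {t} eq _ dn = ≤-by (e - (- t)) (0≤- (≤-trans dn 2E≤e))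
      (trans eq (solve 3 (λ m e t → m :+ t := (m :- e) :+ (e :- (:- t))) refl (a * b) e t))
    high : ∀ {c t} → c ≡ a * b + t → t ≤ E + E → - t ≤ E + E → c ≤ a * b + e
    high {c} {t} eq up _ = subst (_≤ a * b + e) (sym eq) (+-monoʳ-≤ (a * b) (≤-trans up 2E≤e))

  bound : ∀ p q r s → ∃[ K ] (0ℚ < K × p ≤ K × q ≤ K × r ≤ K × s ≤ K)
  bound p q r s =
    let (a , p<) = arch p ; (b , q<) = arch q ; (c , r<) = arch r ; (d , s<) = arch s
        A = ι (suc a) ; B = ι (suc b) ; C = ι (suc c) ; D = ι (suc d)
        K = (A + B) + (C + D)
    in K , 0<+ (0<+ (0<ι a) (0<ι b)) (0<+ (0<ι c) (0<ι d))
     , ≤-trans (<⇒≤ p<) (≤-by (B + (C + D)) (0≤+ (0≤ι (suc b)) (0≤+ (0≤ι (suc c)) (0≤ι (suc d))))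
         (solve 4 (λ A B C D → (A :+ B) :+ (C :+ D) := A :+ (B :+ (C :+ D))) refl A B C D))
     , ≤-trans (<⇒≤ q<) (≤-by (A + (C + D)) (0≤+ (0≤ι (suc a)) (0≤+ (0≤ι (suc c)) (0≤ι (suc d))))
         (solve 4 (λ A B C D → (A :+ B) :+ (C :+ D) := B :+ (A :+ (C :+ D))) refl A B C D))
     , ≤-trans (<⇒≤ r<) (≤-by (A + B + D) (0≤+ (0≤+ (0≤ι (suc a)) (0≤ι (suc b))) (0≤ι (suc d)))
         (solve 4 (λ A B C D → (A :+ B) :+ (C :+ D) := C :+ (A :+ B :+ D)) refl A B C D))
     , ≤-trans (<⇒≤ s<) (≤-by (A + B + C) (0≤+ (0≤+ (0≤ι (suc a)) (0≤ι (suc b))) (0≤ι (suc c)))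
         (solve 4 (λ A B C D → (A :+ B) :+ (C :+ D) := D :+ (A :+ B :+ C)) refl A B C D))

open Products

infixl 7 _*ᴿ_

_*ᴿ_ : ℝ → ℝ → ℝ
x *ᴿ y = record
  { L           = Lower
  ; U           = Upper
  ; L-inhabited = let (a , La) = L-inhabited x ; (a′ , Ua) = U-inhabited x
                      (b , Lb) = L-inhabited y ; (b′ , Ub) = U-inhabited y in
                  lo a a′ b b′ - 1ℚ , a , a′ , b , b′ , La , Ua , Lb , Ub ,
                  <-by 1ℚ 0<1 (solve 1 (λ q → q := (q :- con 1ℚ) :+ con 1ℚ) refl (lo a a′ b b′))
  ; U-inhabited = let (a , La) = L-inhabited x ; (a′ , Ua) = U-inhabited x
                      (b , Lb) = L-inhabited y ; (b′ , Ub) = U-inhabited y in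
                  hi a a′ b b′ + 1ℚ , a , a′ , b , b′ , La , Ua , Lb , Ub , <-by 1ℚ 0<1 refl
  ; L-closed    = λ { q<r (a , a′ , b , b′ , La , Ua , Lb , Ub , r<) →
                      a , a′ , b , b′ , La , Ua , Lb , Ub , <-trans q<r r< }
  ; U-closed    = λ { q<r (a , a′ , b , b′ , La , Ua , Lb , Ub , <q) →
                      a , a′ , b , b′ , La , Ua , Lb , Ub , <-trans <q q<r }
  ; L-open      = λ { (a , a′ , b , b′ , La , Ua , Lb , Ub , q<) → let (r , q<r , r<) = <-dense q< in
                      r , q<r , a , a′ , b , b′ , La , Ua , Lb , Ub , r< }
  ; U-open      = λ { (a , a′ , b , b′ , La , Ua , Lb , Ub , <q) → let (r , <r , r<q) = <-dense <q in
                      r , r<q , a , a′ , b , b′ , La , Ua , Lb , Ub , <r }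
  ; disjoint    = disj
  ; located     = loc
  }
  where
  Lower Upper : ℚ → Set
  Lower q = ∃[ a ] ∃[ a′ ] ∃[ b ] ∃[ b′ ] (L x a × U x a′ × L y b × U y b′ × q < lo a a′ b b′)
  Upper q = ∃[ a ] ∃[ a′ ] ∃[ b ] ∃[ b′ ] (L x a × U x a′ × L y b × U y b′ × hi a a′ b b′ < q)

  disj : ∀ {q} → Lower q → Upper q → ⊥
  disj {q} (a , a′ , b , b′ , La , Ua , Lb , Ub , q<) (c , c′ , d , d′ , Lc , Uc , Ld , Ud , <q) =
    let (z , a≤z , c≤z , Lz) = L-max x La Lc
        (w , b≤w , d≤w , Lw) = L-max y Lb Ld
    in <-irrefl refl (<-trans
         (<-≤-trans q< (lo≤ a≤z (<⇒≤ (L<U x Lz Ua)) b≤w (<⇒≤ (L<U y Lw Ub))))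
         (≤-<-trans (≤hi c≤z (<⇒≤ (L<U x Lz Uc)) d≤w (<⇒≤ (L<U y Lw Ud))) <q))

  loc : ∀ {q p} → q < p → Lower q ⊎ Upper p
  loc {q} {p} q<p =
    let (a₀ , La₀) = L-inhabited x ; (a₁ , Ua₁) = U-inhabited x
        (b₀ , Lb₀) = L-inhabited y ; (b₁ , Ub₁) = U-inhabited y
        (K , 0<K , ka₀ , ka₁ , kb₀ , kb₁) = bound (- a₀) a₁ (- b₀) b₁
        (δ , 0<δ , Kδ≤) = shrink K (e * ½) (0<* 0<e (positive⁻¹ ½))
        (a , a′ , La , Ua , a₀≤a , a′≤a₁ , ha) = approxIn x δ 0<δ La₀ Ua₁
        (b , b′ , Lb , Ub , b₀≤b , b′≤b₁ , hb) = approxIn y δ 0<δ Lb₀ Ub₁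
        a≤a′ = <⇒≤ (L<U x La Ua) ; b≤b′ = <⇒≤ (L<U y Lb Ub)
        (low , high) = corners 0<K (double Kδ≤)
          (≤-trans (neg-antimono-≤ a₀≤a) ka₀) (≤-trans a≤a′ (≤-trans a′≤a₁ ka₁))
          (≤-trans (neg-antimono-≤ b₀≤b) kb₀) (≤-trans b≤b′ (≤-trans b′≤b₁ kb₁))
          (≤-trans (neg-antimono-≤ (≤-trans b₀≤b b≤b′)) kb₀) (≤-trans b′≤b₁ kb₁)
          a≤a′ (gap ha) b≤b′ (gap hb)
    in decide a a′ b b′ La Ua Lb Ub low high
    where
    e = (p - q) * (½ * ½)
    0<e : 0ℚ < e
    0<e = 0<* (0<- q<p) (positive⁻¹ (½ * ½))
    double : ∀ {u} → u ≤ e * ½ → u + u ≤ e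
    double {u} h = subst (u + u ≤_) (solve 1 (λ e → e :* con ½ :+ e :* con ½ := e) refl e) (+-mono-≤ h h)
    gap : ∀ {u v δ} → v < u + δ → v - u ≤ δ
    gap {u} {v} {δ} h = subst (v - u ≤_) (solve 2 (λ u δ → (u :+ δ) :- u := δ) refl u δ) (+-monoˡ-≤ (- u) (<⇒≤ h))
    decide : ∀ a a′ b b′ → L x a → U x a′ → L y b → U y b′ →
      a * b - e ≤ lo a a′ b b′ → hi a a′ b b′ ≤ a * b + e → Lower q ⊎ Upper p
    decide a a′ b b′ La Ua Lb Ub low high with q <? a * b - e
    ... | yes q< = inj₁ (a , a′ , b , b′ , La , Ua , Lb , Ub , <-≤-trans q< low)
    ... | no  q≮ = inj₂ (a , a′ , b , b′ , La , Ua , Lb , Ub , (begin-strict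
      hi a a′ b b′         ≤⟨ high ⟩
      a * b + e            ≡⟨ solve 2 (λ m e → m :+ e := (m :- e) :+ (e :+ e)) refl (a * b) e ⟩
      (a * b - e) + (e + e)  ≤⟨ +-monoˡ-≤ (e + e) (≮⇒≥ q≮) ⟩
      q + (e + e)          <⟨ <-by (e + e) (0<+ 0<e 0<e)
                               (solve 2 (λ p q → p := (q :+ ((p :- q) :* con (½ * ½) :+ (p :- q) :* con (½ * ½)))
                                    :+ ((p :- q) :* con (½ * ½) :+ (p :- q) :* con (½ * ½))) refl p q) ⟩
      p                    ∎))
      where open ≤-Reasoning

fromℕ : ℕ → ℝ
fromℕ n = fromℚ (ι n)

0ᴿ 1ᴿ 2ᴿ 3ᴿ 4ᴿ ½ᴿ : ℝ
0ᴿ = fromℕ 0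
1ᴿ = fromℕ 1
2ᴿ = fromℕ 2
3ᴿ = fromℕ 3
4ᴿ = fromℕ 4
½ᴿ = fromℚ ½

-- The cut of the real power x ^ b for a base x ≥ 1 and any real exponent b:
-- x ^ b is the supremum of the rational powers x ^ r with r < b and the infimum
-- of those with b < r.  The exponent is written r = (m - k) / (1 + n), so that
-- for 0 < s < x < t the bounds v ≤ x ^ r and x ^ r ≤ v follow from the
-- root-free inequalities v ^ (1 + n) * t ^ k ≤ s ^ m and
-- t ^ m ≤ v ^ (1 + n) * s ^ k.
record BelowPower (x b : ℝ) (q : ℚ) : Set where
  constructor below
  field
    m k n   : ℕ
    s t v   : ℚ
    r<b     : L b ((m ⊖ k) / suc n)
    0<s     : 0ℚ < s
    s<x     : L x s
    x<t     : U x t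
    0≤v     : 0ℚ ≤ v
    q<v     : q < v
    v≤      : v ^ suc n * t ^ k ≤ s ^ m

record AbovePower (x b : ℝ) (q : ℚ) : Set where
  constructor above
  field
    m k n   : ℕ
    s t v   : ℚ
    b<r     : U b ((m ⊖ k) / suc n)
    0<s     : 0ℚ < s
    s<x     : L x s
    x<t     : U x t
    0≤v     : 0ℚ ≤ v
    v<q     : v < q
    ≤v      : t ^ m ≤ v ^ suc n * s ^ k

module Powers (x : ℝ) (1≤x : 1ᴿ ≤ᴿ x) (b : ℝ) where

  1≤t : ∀ {t} → U x t → 1ℚ ≤ t
  1≤t {t} Ut = ≮⇒≥ (λ t<1 → disjoint x (1≤x _ t<1) Ut)

  0<t : ∀ {t} → U x t → 0ℚ < t
  0<t Ut = <-≤-trans 0<1 (1≤t Ut)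

  0<½ : 0ℚ < ½
  0<½ = positive⁻¹ ½

  ½+½ : ½ + ½ ≡ 1ℚ
  ½+½ = refl

  ½<1 : ½ < 1ℚ
  ½<1 = <-by ½ 0<½ (sym ½+½)

  tight-aux : ∀ s t M S T → 1ℚ ≤ t → 0ℚ ≤ T → M * (t - s) ≤ ½ →
    T * (t + M * (s - t)) ≤ t * S → T ≤ (1ℚ + 1ℚ) * S
  tight-aux s t M S T 1≤t 0≤T h le = *-cancel-≤ t (<-≤-trans 0<1 1≤t) (begin
    T * t                      ≡⟨ solve 2 (λ T t → T :* t := (con 1ℚ :+ con 1ℚ) :* (T :* (t :- con ½ :* t))) refl T t ⟩
    two * (T * (t - ½ * t))    ≤⟨ *-mono-≤ˡ two 0≤two (*-mono-≤ˡ T 0≤T (≤-by d 0≤d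
                                   (solve 3 (λ t s M → t :+ M :* (s :- t) := (t :- con ½ :* t) :+
                                     (con ½ :* (t :- con 1ℚ) :+ (con ½ :- M :* (t :- s)))) refl t s M))) ⟩
    two * (T * (t + M * (s - t)))  ≤⟨ *-mono-≤ˡ two 0≤two le ⟩
    two * (t * S)              ≡⟨ solve 2 (λ t S → (con 1ℚ :+ con 1ℚ) :* (t :* S) := (con 1ℚ :+ con 1ℚ) :* S :* t) refl t S ⟩
    two * S * t                ∎)
    where
    open ≤-Reasoning
    two = 1ℚ + 1ℚ
    0≤two : 0ℚ ≤ two
    0≤two = <⇒≤ (0<+ 0<1 0<1)
    d = ½ * (t - 1ℚ) + (½ - M * (t - s))
    0≤d : 0ℚ ≤ d
    0≤d = 0≤+ (0≤* (<⇒≤ 0<½) (0≤- 1≤t)) (0≤- h)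

  tight : ∀ {T} M → U x T → ∃[ s ] ∃[ t ]
    (0ℚ < s × L x s × U x t × t ≤ T × t ^ M ≤ (1ℚ + 1ℚ) * s ^ M)
  tight {T} M UT =
    let (δ , 0<δ , Mδ≤) = shrink (ι M) ½ 0<½
        (s , t , Ls , Ut , ½≤s , t≤T , t<s+δ) = approxIn x δ 0<δ (1≤x ½ ½<1) UT
    in s , t , <-≤-trans 0<½ ½≤s , Ls , Ut , t≤T , close δ s t ½≤s Ut t<s+δ Mδ≤
    where
    gap : ∀ {u v δ} → v < u + δ → v - u ≤ δ
    gap {u} {v} {δ} h = subst (v - u ≤_) (solve 2 (λ u δ → (u :+ δ) :- u := δ) refl u δ) (+-monoˡ-≤ (- u) (<⇒≤ h))
    close : ∀ δ s t → ½ ≤ s → U x t → t < s + δ → ι M * δ ≤ ½ → t ^ M ≤ (1ℚ + 1ℚ) * s ^ M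
    close δ s t ½≤s Ut t<s+δ Mδ≤ = tight-aux s t (ι M) (s ^ M) (t ^ M) (1≤t Ut) (0≤^ M (<⇒≤ (0<t Ut)))
      (≤-trans (*-mono-≤ˡ (ι M) (0≤ι M) (gap {s} {t} {δ} t<s+δ)) Mδ≤)
      (bernoulli s t M (<⇒≤ (<-≤-trans 0<½ ½≤s)) (<⇒≤ (0<t Ut)))

  negative-below : ∀ {q} → q < 0ℚ → BelowPower x b q
  negative-below {q} q<0 =
    let (m , k , Lm , _) = grid b 0
        (t , Ut) = U-inhabited x
    in below m k 0 ½ t 0ℚ Lm 0<½ (1≤x ½ ½<1) Ut ≤-refl q<0
         (subst (_≤ ½ ^ m) (sym (null m k t)) (0≤^ m (<⇒≤ 0<½)))
    where
    null : ∀ m k t → 0ℚ ^ 1 * t ^ k ≡ 0ℚ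
    null m k t = trans (cong (_* t ^ k) (*-zeroˡ 1ℚ)) (*-zeroˡ (t ^ k))

  some-above : ∃[ q ] AbovePower x b q
  some-above =
    let (m , k , _ , Um) = grid b 0
        (t , Ut) = U-inhabited x
    in r (suc (suc m)) k t + 1ℚ ,
       above (suc (suc m)) k 0 ½ t (r (suc (suc m)) k t) Um 0<½ (1≤x ½ ½<1) Ut
         (0≤* (0≤^ (suc (suc m)) (<⇒≤ (0<t Ut))) (0≤^ k (<⇒≤ (0<+ 0<1 0<1))))
         (<-by 1ℚ 0<1 refl) (≤-reflexive (eq k (t ^ suc (suc m))))
    where
    two = 1ℚ + 1ℚ
    r : ℕ → ℕ → ℚ → ℚ
    r m k t = t ^ m * two ^ k
    cancel : ∀ k → two ^ k * ½ ^ k ≡ 1ℚ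
    cancel k = trans (sym (^-distrib-* two ½ k)) (one k)
      where
      one : ∀ k → (two * ½) ^ k ≡ 1ℚ
      one ℕ.zero = refl
      one (suc k) = trans (*-identityˡ ((two * ½) ^ k)) (one k)
    eq : ∀ k T → T ≡ (T * two ^ k) ^ 1 * ½ ^ k
    eq k T = sym (trans (cong (_* ½ ^ k) (*-identityʳ (T * two ^ k)))
      (trans (*-assoc T (two ^ k) (½ ^ k)) (trans (cong (T *_) (cancel k)) (*-identityʳ T))))

  separate-aux : ∀ {Q P X Y A B} → 0ℚ < X → 0ℚ < Y →
    Q * X ≤ A → B ≤ P * Y → A * Y ≤ B * X → Q ≤ P
  separate-aux {Q} {P} {X} {Y} {A} {B} 0<X 0<Y QX≤A B≤PY AY≤BX = *-cancel-≤ (X * Y) (0<* 0<X 0<Y) (begin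
    Q * (X * Y)   ≡⟨ sym (*-assoc Q X Y) ⟩
    Q * X * Y     ≤⟨ *-monoʳ-≤-nonNeg Y {{nonNegative (<⇒≤ 0<Y)}} QX≤A ⟩
    A * Y         ≤⟨ AY≤BX ⟩
    B * X         ≤⟨ *-monoʳ-≤-nonNeg X {{nonNegative (<⇒≤ 0<X)}} B≤PY ⟩
    P * Y * X     ≡⟨ solve 3 (λ P X Y → P :* Y :* X := P :* (X :* Y)) refl P X Y ⟩
    P * (X * Y)   ∎)
    where open ≤-Reasoning

  separate : ∀ {q} → BelowPower x b q → AbovePower x b q → ⊥
  separate {q} (below m k n s t r Lb 0<s Ls Ut 0≤r q<r lo)
               (above m′ k′ n′ s′ t′ r′ Ub 0<s′ Ls′ Ut′ 0≤r′ r′<q hi) =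
    <-irrefl refl (<-trans q<r (≤-<-trans r≤r′ r′<q))
    where
    N = suc n
    N′ = suc n′
    split : ∀ u i v j e → (u ^ i * v ^ j) ^ e ≡ u ^ (i ℕ.* e) * v ^ (j ℕ.* e)
    split u i v j e = trans (^-distrib-* (u ^ i) (v ^ j) e) (cong₂ _*_ (^-assocʳ u i e) (^-assocʳ v j e))
    0≤s = <⇒≤ 0<s
    0≤s′ = <⇒≤ 0<s′
    0≤t = <⇒≤ (0<t Ut)
    0≤t′ = <⇒≤ (0<t Ut′)
    A : r ^ (N ℕ.* N′) * t ^ (k ℕ.* N′) ≤ s ^ (m ℕ.* N′)
    A = subst₂ _≤_ (split r N t k N′) (^-assocʳ s m N′)
          (^-mono N′ (0≤* (0≤^ N 0≤r) (0≤^ k 0≤t)) lo)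
    B : t′ ^ (m′ ℕ.* N) ≤ r′ ^ (N ℕ.* N′) * s′ ^ (k′ ℕ.* N)
    B = subst₂ _≤_ (^-assocʳ t′ m′ N)
          (trans (split r′ N′ s′ k′ N) (cong (λ j → r′ ^ j * s′ ^ (k′ ℕ.* N)) (ℕₚ.*-comm N′ N)))
          (^-mono N (0≤^ m′ 0≤t′) hi)
    C : s ^ (m ℕ.* N′) * s′ ^ (k′ ℕ.* N) ≤ t′ ^ (m′ ℕ.* N) * t ^ (k ℕ.* N′)
    C = let (τ , τ≤t , τ≤t′ , Uτ) = U-min x Ut Ut′
            0≤τ = <⇒≤ (0<t Uτ)
            i = m ℕ.* N′ ; j = k′ ℕ.* N ; i′ = m′ ℕ.* N ; j′ = k ℕ.* N′
            in ≤-trans (*-mono-≤² (0≤^ j 0≤s′) (0≤^ i 0≤τ)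
                 (^-mono i 0≤s (<⇒≤ (L<U x Ls Uτ))) (^-mono j 0≤s′ (<⇒≤ (L<U x Ls′ Uτ))))
               (≤-trans (≤-reflexive (sym (^-homo-* τ i j)))
               (≤-trans (^-monoⁿ (1≤t Uτ) (frac-cross m k n m′ k′ n′ (L<U b Lb Ub)))
               (≤-trans (≤-reflexive (^-homo-* τ i′ j′))
                 (*-mono-≤² (0≤^ j′ 0≤τ) (0≤^ i′ 0≤t′) (^-mono i′ 0≤τ τ≤t′) (^-mono j′ 0≤τ τ≤t)))))
    r≤r′ : r ≤ r′
    r≤r′ = ^-cancel (n′ ℕ.+ n ℕ.* N′) 0≤r 0≤r′
      (separate-aux (0<^ (k ℕ.* N′) (0<t Ut)) (0<^ (k′ ℕ.* N) 0<s′) A B C)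

  locate-aux : ∀ {P Q sm sk tm tk t T} → 0ℚ ≤ sm → 0ℚ < sk → 0ℚ < tk → 0ℚ ≤ t → t ≤ T →
    tm * tk ≤ (1ℚ + 1ℚ) * (sm * sk) → sm ≤ Q * tk → (1ℚ + 1ℚ) * (T * T) * Q ≤ P → 0ℚ ≤ Q →
    t * (t * tm) ≤ P * sk
  locate-aux {P} {Q} {sm} {sk} {tm} {tk} {t} {T} 0≤sm 0<sk 0<tk 0≤t t≤T h₁ h₂ h₃ 0≤Q =
    *-cancel-≤ tk 0<tk (begin
    t * (t * tm) * tk         ≡⟨ solve 3 (λ t tm tk → t :* (t :* tm) :* tk := (t :* t) :* (tm :* tk)) refl t tm tk ⟩
    (t * t) * (tm * tk)       ≤⟨ *-mono-≤ˡ (t * t) (0≤* 0≤t 0≤t) h₁ ⟩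
    (t * t) * (two * (sm * sk)) ≤⟨ *-monoʳ-≤-nonNeg (two * (sm * sk)) {{nonNegative (0≤* 0≤two (0≤* 0≤sm (<⇒≤ 0<sk)))}}
                                   (*-mono-≤² 0≤t (≤-trans 0≤t t≤T) t≤T t≤T) ⟩
    (T * T) * (two * (sm * sk)) ≡⟨ solve 3 (λ T sm sk → (T :* T) :* ((con 1ℚ :+ con 1ℚ) :* (sm :* sk)) := ((con 1ℚ :+ con 1ℚ) :* (T :* T) :* sk) :* sm) refl T sm sk ⟩
    (two * (T * T) * sk) * sm ≤⟨ *-mono-≤ˡ (two * (T * T) * sk) (0≤* (0≤* 0≤two (0≤* 0≤T 0≤T)) (<⇒≤ 0<sk)) h₂ ⟩
    (two * (T * T) * sk) * (Q * tk) ≡⟨ solve 4 (λ T sk Q tk → ((con 1ℚ :+ con 1ℚ) :* (T :* T) :* sk) :* (Q :* tk)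
                                        := (sk :* tk) :* ((con 1ℚ :+ con 1ℚ) :* (T :* T) :* Q)) refl T sk Q tk ⟩
    (sk * tk) * (two * (T * T) * Q) ≤⟨ *-mono-≤ˡ (sk * tk) (<⇒≤ (0<* 0<sk 0<tk)) h₃ ⟩
    (sk * tk) * P             ≡⟨ solve 3 (λ sk tk P → (sk :* tk) :* P := P :* sk :* tk) refl sk tk P ⟩
    P * sk * tk               ∎)
    where
    open ≤-Reasoning
    two = 1ℚ + 1ℚ
    0≤two : 0ℚ ≤ two
    0≤two = <⇒≤ (0<+ 0<1 0<1)
    0≤T = ≤-trans 0≤t t≤T

  locate : ∀ {q p} → q < p → BelowPower x b q ⊎ AbovePower x b p
  locate {q} {p} q<p with q <? 0ℚ
  ... | yes q<0 = inj₁ (negative-below q<0)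
  ... | no  q≮0 =
    let (q₁ , q<q₁ , q₁<p) = <-dense q<p
        (p₁ , q₁<p₁ , p₁<p) = <-dense q₁<p
        0<q₁ = ≤-<-trans (≮⇒≥ q≮0) q<q₁
        (T , UT) = U-inhabited x
        (n , big) = geometric ((1ℚ + 1ℚ) * (T * T)) 0<q₁ q₁<p₁
        (m , k , Lm , Um) = grid b n
        (s , t , 0<s , Ls , Ut , t≤T , close) = tight (m ℕ.+ k) UT
    in decide q₁ p₁ T m k n s t 0<q₁ q₁<p₁ q<q₁ p₁<p big Lm Um 0<s Ls Ut t≤T close
           (q₁ ^ suc n * t ^ k ≤? s ^ m)
    where
    decide : ∀ q₁ p₁ T m k n s t → 0ℚ < q₁ → q₁ < p₁ → q < q₁ → p₁ < p →
      (1ℚ + 1ℚ) * (T * T) * q₁ ^ suc n < p₁ ^ suc n →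
      L b (frac m k n) → U b (frac (suc (suc m)) k n) →
      0ℚ < s → L x s → U x t → t ≤ T →
      t ^ (m ℕ.+ k) ≤ (1ℚ + 1ℚ) * s ^ (m ℕ.+ k) →
      Dec (q₁ ^ suc n * t ^ k ≤ s ^ m) →
      BelowPower x b q ⊎ AbovePower x b p
    decide q₁ p₁ T m k n s t 0<q₁ q₁<p₁ q<q₁ p₁<p big Lm Um 0<s Ls Ut t≤T close (yes le) =
      inj₁ (below m k n s t q₁ Lm 0<s Ls Ut (<⇒≤ 0<q₁) q<q₁ le)
    decide q₁ p₁ T m k n s t 0<q₁ q₁<p₁ q<q₁ p₁<p big Lm Um 0<s Ls Ut t≤T close (no ¬le) =
      inj₂ (above (suc (suc m)) k n s t p₁ Um 0<s Ls Ut (<⇒≤ (<-trans 0<q₁ q₁<p₁)) p₁<p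
        (locate-aux {P = p₁ ^ suc n} {Q = q₁ ^ suc n} {sm = s ^ m} {sk = s ^ k} {tm = t ^ m} {tk = t ^ k} {t = t} {T = T}
          (0≤^ m (<⇒≤ 0<s)) (0<^ k 0<s) (0<^ k (0<t Ut)) (<⇒≤ (0<t Ut)) t≤T
          (subst₂ _≤_ (^-homo-* t m k) (cong ((1ℚ + 1ℚ) *_) (^-homo-* s m k)) close)
          (<⇒≤ (≰⇒> ¬le)) (<⇒≤ big) (0≤^ (suc n) (<⇒≤ 0<q₁))))

  power : ℝ
  power = record
    { L           = BelowPower x b
    ; U           = AbovePower x b
    ; L-inhabited = - 1ℚ , negative-below (neg-antimono-< 0<1)
    ; U-inhabited = some-above
    ; L-closed    = λ { q<q′ (below m k n s t r Lb 0<s Ls Ut 0≤r q′<r h) →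
                        below m k n s t r Lb 0<s Ls Ut 0≤r (<-trans q<q′ q′<r) h }
    ; U-closed    = λ { q<q′ (above m k n s t r Ub 0<s Ls Ut 0≤r r<q h) →
                        above m k n s t r Ub 0<s Ls Ut 0≤r (<-trans r<q q<q′) h }
    ; L-open      = λ { (below m k n s t r Lb 0<s Ls Ut 0≤r q<r h) →
                        let (q′ , q<q′ , q′<r) = <-dense q<r in
                        q′ , q<q′ , below m k n s t r Lb 0<s Ls Ut 0≤r q′<r h }
    ; U-open      = λ { (above m k n s t r Ub 0<s Ls Ut 0≤r r<q h) →
                        let (q′ , r<q′ , q′<q) = <-dense r<q in
                        q′ , q′<q , above m k n s t r Ub 0<s Ls Ut 0≤r r<q′ h }
    ; disjoint    = separate
    ; located     = locate
    }

infix 9 _^⟨_⟩_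

_^⟨_⟩_ : (x : ℝ) → 1ᴿ ≤ᴿ x → ℝ → ℝ
x ^⟨ 1≤x ⟩ b = Powers.power x 1≤x b

OnCurve : (a b x y : ℚ) → Set
OnCurve a b x y = y * y ≡ x * x * x + a * x + b

-- Rational points of the projective curve y² = x³ + a x + b; 𝒪 is the point
-- at infinity.
data Point (a b : ℚ) : Set where
  𝒪      : Point a b
  affine : (x y : ℚ) → OnCurve a b x y → Point a b

module ChordTangent {a b : ℚ} where

  -- The line of slope l through (x₁, y₁) meets the curve with abscissas
  -- x₁, x₂, x₃, and (x₃, y₃) is the reflection of the third intersection.
  x₃ : (x₁ x₂ l : ℚ) → ℚ
  x₃ x₁ x₂ l = l * l - x₁ - x₂

  y₃ : (x₁ y₁ x₂ l : ℚ) → ℚ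
  y₃ x₁ y₁ x₂ l = l * (x₁ - x₃ x₁ x₂ l) - y₁

  residual : (x₁ y₁ x₂ l : ℚ) → ℚ
  residual x₁ y₁ x₂ l =
    (x₁ * x₁ + x₁ * x₁ + x₁ * x₁ + a - l * (y₁ + y₁))
    + (x₂ - x₁) * (x₁ + x₁ + x₁ + (x₂ - x₁) - l * l)

  closed : ∀ x₁ y₁ x₂ l → OnCurve a b x₁ y₁ → residual x₁ y₁ x₂ l ≡ 0ℚ →
    OnCurve a b (x₃ x₁ x₂ l) (y₃ x₁ y₁ x₂ l)
  closed x₁ y₁ x₂ l e₁ h = begin
    y * y
      ≡⟨ solve 6 (λ a b x₁ y₁ x₂ l →
           let x = l :* l :- x₁ :- x₂ ; y = l :* (x₁ :- x) :- y₁ in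
           y :* y := (x :* x :* x :+ a :* x :+ b)
             :+ (y₁ :* y₁ :- (x₁ :* x₁ :* x₁ :+ a :* x₁ :+ b))
             :- (x :- x₁) :* ((x₁ :* x₁ :+ x₁ :* x₁ :+ x₁ :* x₁ :+ a :- l :* (y₁ :+ y₁))
                 :+ (x₂ :- x₁) :* (x₁ :+ x₁ :+ x₁ :+ (x₂ :- x₁) :- l :* l)))
           refl a b x₁ y₁ x₂ l ⟩
    f x + (y₁ * y₁ - f x₁) - (x - x₁) * residual x₁ y₁ x₂ l
      ≡⟨ cong₂ (λ u v → f x + (u - f x₁) - (x - x₁) * v) e₁ h ⟩
    f x + (f x₁ - f x₁) - (x - x₁) * 0ℚ
      ≡⟨ solve 3 (λ u v d → u :+ (v :- v) :- d :* con 0ℚ := u) refl (f x) (f x₁) (x - x₁) ⟩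
    f x ∎
    where
    open ≡-Reasoning
    x = x₃ x₁ x₂ l
    y = y₃ x₁ y₁ x₂ l
    f : ℚ → ℚ
    f z = z * z * z + a * z + b

  *-cancel-0 : ∀ {d z} → d ≢ 0ℚ → d * z ≡ 0ℚ → z ≡ 0ℚ
  *-cancel-0 {d} {z} d≢0 dz≡0 = begin
    z                  ≡⟨ sym (*-identityˡ z) ⟩
    1ℚ * z             ≡⟨ cong (_* z) (sym (*-inverseˡ d)) ⟩
    (1/ d) * d * z     ≡⟨ *-assoc (1/ d) d z ⟩
    (1/ d) * (d * z)   ≡⟨ cong ((1/ d) *_) dz≡0 ⟩
    (1/ d) * 0ℚ        ≡⟨ *-zeroʳ (1/ d) ⟩
    0ℚ                 ∎
    where
    open ≡-Reasoning
    instance _ = ≢-nonZero d≢0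

  ÷-* : ∀ n d .{{_ : NonZero d}} → (n ÷ d) * d ≡ n
  ÷-* n d = trans (*-assoc n (1/ d) d) (trans (cong (n *_) (*-inverseˡ d)) (*-identityʳ n))

  diff≢0 : ∀ {x₁ x₂} → x₁ ≢ x₂ → x₂ - x₁ ≢ 0ℚ
  diff≢0 {x₁} {x₂} x₁≢x₂ eq = x₁≢x₂ (begin
    x₁               ≡⟨ sym (+-identityˡ x₁) ⟩
    0ℚ + x₁          ≡⟨ cong (_+ x₁) (sym eq) ⟩
    (x₂ - x₁) + x₁   ≡⟨ solve 2 (λ u v → (v :- u) :+ u := v) refl x₁ x₂ ⟩
    x₂               ∎)
    where open ≡-Reasoning

  secant : (x₁ y₁ x₂ y₂ : ℚ) → x₁ ≢ x₂ → ℚ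
  secant x₁ y₁ x₂ y₂ x₁≢x₂ = ((y₂ - y₁) ÷ (x₂ - x₁)) {{≢-nonZero (diff≢0 x₁≢x₂)}}

  tangent : (x₁ y₁ : ℚ) → y₁ + y₁ ≢ 0ℚ → ℚ
  tangent x₁ y₁ 2y₁≢0 =
    ((x₁ * x₁ + x₁ * x₁ + x₁ * x₁ + a) ÷ (y₁ + y₁)) {{≢-nonZero 2y₁≢0}}

  secant-residual : ∀ x₁ y₁ x₂ y₂ l → x₁ ≢ x₂ → l * (x₂ - x₁) ≡ y₂ - y₁ →
    OnCurve a b x₁ y₁ → OnCurve a b x₂ y₂ → residual x₁ y₁ x₂ l ≡ 0ℚ
  secant-residual x₁ y₁ x₂ y₂ l x₁≢x₂ hl e₁ e₂ = *-cancel-0 (diff≢0 x₁≢x₂) (begin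
    (x₂ - x₁) * residual x₁ y₁ x₂ l
      ≡⟨ solve 6 (λ a b x₁ y₁ x₂ l → let y = l :* (x₂ :- x₁) :+ y₁ in
           (x₂ :- x₁) :* ((x₁ :* x₁ :+ x₁ :* x₁ :+ x₁ :* x₁ :+ a :- l :* (y₁ :+ y₁))
                 :+ (x₂ :- x₁) :* (x₁ :+ x₁ :+ x₁ :+ (x₂ :- x₁) :- l :* l))
           := (y₁ :* y₁ :- (x₁ :* x₁ :* x₁ :+ a :* x₁ :+ b))
              :- (y :* y :- (x₂ :* x₂ :* x₂ :+ a :* x₂ :+ b))) refl a b x₁ y₁ x₂ l ⟩
    (y₁ * y₁ - f x₁) - ((l * (x₂ - x₁) + y₁) * (l * (x₂ - x₁) + y₁) - f x₂)
      ≡⟨ cong (λ u → (y₁ * y₁ - f x₁) - (u * u - f x₂))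
           (trans (cong (_+ y₁) hl) (solve 2 (λ u v → (v :- u) :+ u := v) refl y₁ y₂)) ⟩
    (y₁ * y₁ - f x₁) - (y₂ * y₂ - f x₂)
      ≡⟨ cong₂ (λ u v → (u - f x₁) - (v - f x₂)) e₁ e₂ ⟩
    (f x₁ - f x₁) - (f x₂ - f x₂)
      ≡⟨ solve 2 (λ u v → (u :- u) :- (v :- v) := con 0ℚ) refl (f x₁) (f x₂) ⟩
    0ℚ ∎)
    where
    open ≡-Reasoning
    f : ℚ → ℚ
    f z = z * z * z + a * z + b

  tangent-residual : ∀ x₁ y₁ l →
    l * (y₁ + y₁) ≡ x₁ * x₁ + x₁ * x₁ + x₁ * x₁ + a → residual x₁ y₁ x₁ l ≡ 0ℚ
  tangent-residual x₁ y₁ l hl = trans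
    (cong (λ u → (t - u) + (x₁ - x₁) * (x₁ + x₁ + x₁ + (x₁ - x₁) - l * l)) hl)
    (solve 3 (λ t x l → (t :- t) :+ (x :- x) :* (x :+ x :+ x :+ (x :- x) :- l :* l) := con 0ℚ) refl t x₁ l)
    where
    t = x₁ * x₁ + x₁ * x₁ + x₁ * x₁ + a

  same-y : ∀ x {y₁ y₂} → OnCurve a b x y₁ → OnCurve a b x y₂ → y₁ + y₂ ≢ 0ℚ → y₁ ≡ y₂
  same-y x {y₁} {y₂} e₁ e₂ s≢0 = begin
    y₁               ≡⟨ solve 2 (λ u v → u := (u :- v) :+ v) refl y₁ y₂ ⟩
    (y₁ - y₂) + y₂   ≡⟨ cong (_+ y₂) (*-cancel-0 s≢0 (begin
        (y₁ + y₂) * (y₁ - y₂)   ≡⟨ solve 2 (λ u v → (u :+ v) :* (u :- v) := u :* u :- v :* v) refl y₁ y₂ ⟩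
        y₁ * y₁ - y₂ * y₂       ≡⟨ cong₂ _-_ e₁ e₂ ⟩
        f - f                   ≡⟨ +-inverseʳ f ⟩
        0ℚ                      ∎)) ⟩
    0ℚ + y₂          ≡⟨ +-identityˡ y₂ ⟩
    y₂               ∎
    where
    open ≡-Reasoning
    f = x * x * x + a * x + b

  add-affine : ∀ x₁ y₁ x₂ y₂ → OnCurve a b x₁ y₁ → OnCurve a b x₂ y₂ →
    Dec (x₁ ≡ x₂) → Dec (y₁ + y₂ ≡ 0ℚ) → Point a b
  add-affine x₁ y₁ x₂ y₂ e₁ e₂ (no x₁≢x₂) _ =
    affine (x₃ x₁ x₂ l) (y₃ x₁ y₁ x₂ l)
      (closed x₁ y₁ x₂ l e₁ (secant-residual x₁ y₁ x₂ y₂ l x₁≢x₂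
        (÷-* (y₂ - y₁) (x₂ - x₁) {{≢-nonZero (diff≢0 x₁≢x₂)}}) e₁ e₂))
    where l = secant x₁ y₁ x₂ y₂ x₁≢x₂
  add-affine x₁ y₁ x₂ y₂ e₁ e₂ (yes _) (yes _) = 𝒪
  add-affine x₁ y₁ x₂ y₂ e₁ e₂ (yes x₁≡x₂) (no y₁+y₂≢0) =
    affine (x₃ x₁ x₁ l) (y₃ x₁ y₁ x₁ l)
      (closed x₁ y₁ x₁ l e₁ (tangent-residual x₁ y₁ l
        (÷-* (x₁ * x₁ + x₁ * x₁ + x₁ * x₁ + a) (y₁ + y₁) {{≢-nonZero 2y₁≢0}})))
    where
    2y₁≢0 : y₁ + y₁ ≢ 0ℚ
    2y₁≢0 eq = y₁+y₂≢0 (trans (cong (y₁ +_) (sym (same-y x₁ e₁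
      (subst (λ x → OnCurve a b x y₂) (sym x₁≡x₂) e₂) y₁+y₂≢0))) eq)
    l = tangent x₁ y₁ 2y₁≢0

infixl 6 _⊕_

_⊕_ : ∀ {a b} → Point a b → Point a b → Point a b
𝒪 ⊕ Q = Q
P@(affine _ _ _) ⊕ 𝒪 = P
affine x₁ y₁ e₁ ⊕ affine x₂ y₂ e₂ =
  ChordTangent.add-affine x₁ y₁ x₂ y₂ e₁ e₂ (x₁ ≟ x₂) (y₁ + y₂ ≟ 0ℚ)

-- E[3](ℚ)
3-Torsion : ∀ {a b} → Point a b → Set
3-Torsion P = P ⊕ P ⊕ P ≡ 𝒪

disc : ℤ → ℤ → ℤ
disc A B = ℤ.- (ℤ.+ 16 ℤ.* (ℤ.+ 4 ℤ.* A ℤ.^ 3 ℤ.+ ℤ.+ 27 ℤ.* B ℤ.^ 2))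

-- Meant for M₁, M₂ ≥ 0 and N₁, N₂ > 0.  Since (A , B) are the coefficients of an
-- integral short Weierstrass equation, being an elliptic curve is disc A B ≢ 0.
S : (M₁ N₁ M₂ N₂ : ℝ) → ℤ × ℤ → Set
S M₁ N₁ M₂ N₂ (A , B) =
    (M₁ ≤ᴿ fromℕ ℤ.∣ A ∣ × fromℕ ℤ.∣ A ∣ ≤ᴿ M₁ +ᴿ N₁)
  × (M₂ ≤ᴿ fromℕ ℤ.∣ B ∣ × fromℕ ℤ.∣ B ∣ ≤ᴿ M₂ +ᴿ N₂)
  × disc A B ≢ ℤ.0ℤ
  × ∃[ P ] (3-Torsion {A / 1} {B / 1} P × P ≢ 𝒪)

infix 4 #_≤_

-- The cardinality of X is at most r.  Membership in X need not be decidable, so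
-- this is expressed by bounding every finite list of distinct elements.
#_≤_ : (ℤ × ℤ → Set) → ℝ → Set
# X ≤ r = ∀ xs → Unique xs → All X xs → fromℕ (length xs) ≤ᴿ r

module Submission where

-- If P ≠ 𝒪 has order 3, the tangent y = l x + m at P meets the curve only at P, so
-- x³ + A x + B - (l x + m)² is a cube.  Writing l = 3u this gives A = 6um + 27u⁴ and
-- B = m² - 27u⁶, and integrality of A and B forces u and m to be integers.  For a fixed A,
-- two such pairs with u, u′ > 0 satisfy |B - B′| ≥ (u - u′)², by
--   36tt′(B - B′) = (t′ - t)((A + 27tt′)² + 243tt′(t - t′)²),  t = u², t′ = u′²,
-- and when u = 0 then B = m², with the same separation in m.  So a window of length N
-- for |B| contains O(√N) admissible B for each A, which gives O(J^b · J^(c/2)) pairs;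
-- this suffices as min(b, c) ≤ c.

open import Algebra.Bundles using (module CommutativeRing)
open import Data.Empty using (⊥-elim)
open import Data.Fin.Base using (Fin; zero; suc; combine; toℕ)
open import Data.Fin.Properties using (combine-injective; injective⇒≤; toℕ-fromℕ<)
open import Data.Integer as ℤ using (ℤ; -[1+_]; _⊖_)
open import Data.Integer.Divisibility.Signed as Signed using (∣ᵤ⇒∣)
import Data.Integer.Properties as ℤₚ
open import Data.List.Base using (List; length; lookup; _∷_)
open import Data.List.Membership.Propositional.Properties using (∈-lookup)
open import Data.List.Relation.Unary.All as All using (All)
open import Data.List.Relation.Unary.AllPairs using (_∷_)
open import Data.List.Relation.Unary.Unique.Propositional using (Unique)
open import Data.Nat as ℕ using (ℕ; zero; suc)
open import Data.Nat.Coprimality as Coprimality using (Coprime; coprime-divisor)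
open import Data.Nat.DivMod using (_mod_; _%_; m≡m%n+[m/n]*n; m%n<n)
open import Data.Nat.Divisibility using (_∣_; ∣1⇒≡1; m∣m*n)
open import Data.Nat.Primality using (Prime; prime?; euclidsLemma)
import Data.Nat.Properties as ℕₚ
open import Data.Nat.Solver using () renaming (module +-*-Solver to ℕ-Solver)
open ℕ-Solver using ()
  renaming (solve to ℕ-solve; con to ℕcon; _:=_ to _ℕ:=_; _:+_ to _ℕ:+_; _:*_ to _ℕ:*_)
open import Data.Product using (∃-syntax; _×_; _,_; proj₂)
open import Data.Sum using (inj₁; inj₂; [_,_]′)
open import Function.Base using (id)
open import Relation.Binary.PropositionalEquality
open import Relation.Nullary using (yes; no; recompute)
open import Relation.Nullary.Decidable using (from-yes)
open import Defs

-- Integral flexes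

-- The coefficients of x³ + A x + B - (3u x + m)² = (x - 3u²)³: the tangent has slope 3u and
-- intercept m, and it touches the curve at abscissa 3u².
record HasFlex (A B : ℤ) : Set where
  constructor hasFlex
  field
    u m : ℤ
    A≡  : A ≡ ℤ.+ 6 ℤ.* u ℤ.* m ℤ.+ ℤ.+ 27 ℤ.* u ℤ.* u ℤ.* u ℤ.* u
    B≡  : B ≡ m ℤ.* m ℤ.- ℤ.+ 27 ℤ.* u ℤ.* u ℤ.* u ℤ.* u ℤ.* u ℤ.* u

-- Separation of flexes with the same A

module Shapes where
  open import Data.Integer using (+_; ∣_∣; _+_; _*_; _-_; -_; _≤_; 0ℤ; +≤+; Positive; positive)
  open import Data.Integer.Properties
  open import Data.Integer.Solver using (module +-*-Solver)
  open import Algebra.Properties.AbelianGroup +-0-abelianGroup using (∙-cancelʳ)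
  open +-*-Solver

  ≤-by : ∀ {i j} k → 0ℤ ≤ k → j ≡ i + k → i ≤ j
  ≤-by {i} k 0≤k eq = subst₂ _≤_ (+-identityʳ i) (sym eq) (+-monoʳ-≤ i 0≤k)

  0≤* : ∀ {i j} → 0ℤ ≤ i → 0ℤ ≤ j → 0ℤ ≤ i * j
  0≤* {+ m} {+ n} (+≤+ _) (+≤+ _) = subst (0ℤ ≤_) (pos-* m n) (+≤+ ℕ.z≤n)

  positive-* : ∀ i j .{{_ : Positive i}} .{{_ : Positive j}} → Positive (i * j)
  positive-* (+ suc m) (+ suc n) = _

  0≤pos : ∀ n → 0ℤ ≤ + n
  0≤pos n = +≤+ ℕ.z≤n

  0≤+ : ∀ {i j} → 0ℤ ≤ i → 0ℤ ≤ j → 0ℤ ≤ i + j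
  0≤+ = +-mono-≤

  i*i≡∣i∣² : ∀ i → i * i ≡ + (∣ i ∣ ℕ.* ∣ i ∣)
  i*i≡∣i∣² (+ n) = sym (pos-* n n)
  i*i≡∣i∣² -[1+ n ] = refl

  0≤i*i : ∀ i → 0ℤ ≤ i * i
  0≤i*i i = subst (0ℤ ≤_) (sym (i*i≡∣i∣² i)) (+≤+ ℕ.z≤n)

  -- Here t = u² and M = m², so the hypotheses are (6um)² = (A - 27u⁴)² and the right-hand
  -- side of the conclusion is B - B′.
  gap : ∀ {t s A M N ε} .{{_ : Positive t}} → 0ℤ ≤ ε → s ≡ t + (+ 1 + ε) →
    + 36 * t * M ≡ (A - + 27 * t * t) * (A - + 27 * t * t) →
    + 36 * s * N ≡ (A - + 27 * s * s) * (A - + 27 * s * s) →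
    + 1 + ε ≤ (M - + 27 * t * t * t) - (N - + 27 * s * s * s)
  gap {t} {s} {A} {M} {N} {ε} 0≤ε refl M≡ N≡ = *-cancelˡ-≤-pos _ _ K (≤-by D 0≤D (begin
    K * ((M - + 27 * t * t * t) - (N - + 27 * s * s * s))
      ≡⟨ solve 4 (λ t s M N → con (+ 36) :* t :* s :* ((M :- con (+ 27) :* t :* t :* t) :- (N :- con (+ 27) :* s :* s :* s))
           := s :* (con (+ 36) :* t :* M) :- t :* (con (+ 36) :* s :* N) :- con (+ 972) :* t :* s :* (t :* t :* t :- s :* s :* s))
           refl t s M N ⟩
    s * (+ 36 * t * M) - t * (+ 36 * s * N) - + 972 * t * s * (t * t * t - s * s * s)
      ≡⟨ cong₂ (λ u v → s * u - t * v - + 972 * t * s * (t * t * t - s * s * s)) M≡ N≡ ⟩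
    s * (a * a) - t * (b * b) - + 972 * t * s * (t * t * t - s * s * s)
      ≡⟨ solve 3 (λ t ε A → let s = t :+ (con (+ 1) :+ ε)
                                a = A :- con (+ 27) :* t :* t
                                b = A :- con (+ 27) :* s :* s
                                c = A :+ con (+ 27) :* t :* s in
           s :* (a :* a) :- t :* (b :* b) :- con (+ 972) :* t :* s :* (t :* t :* t :- s :* s :* s)
           := con (+ 36) :* t :* s :* (con (+ 1) :+ ε) :+ (con (+ 1) :+ ε) :* (c :* c :+ t :* s :*
                (con (+ 243) :* (ε :* ε) :+ con (+ 486) :* ε :+ con (+ 207)))) refl t ε A ⟩
    K * (+ 1 + ε) + D ∎))
    where
    open ≡-Reasoning
    K = + 36 * t * s
    a = A - + 27 * t * t
    b = A - + 27 * s * s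
    c = A + + 27 * t * s
    -- The last factor is 243(1 + ε)² - 36. The 36 pays for `K * (+ 1 + ε)`, and it is affordable
    -- because s - t = 1 + ε is at least 1, which leaves the constant 207.
    D = (+ 1 + ε) * (c * c + t * s * (+ 243 * (ε * ε) + + 486 * ε + + 207))
    0<s : Positive s
    0<s = positive (<-≤-trans (positive⁻¹ t) (≤-by (+ 1 + ε) (0≤+ (+≤+ ℕ.z≤n) 0≤ε) refl))
    instance
      0<K : Positive K
      0<K = positive-* (+ 36 * t) s {{positive-* (+ 36) t}} {{0<s}}
    0≤D : 0ℤ ≤ D
    0≤D = 0≤* (0≤+ (0≤pos 1) 0≤ε) (0≤+ (0≤i*i c)
      (0≤* (0≤* (<⇒≤ (positive⁻¹ t)) (<⇒≤ (positive⁻¹ s {{0<s}})))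
        (0≤+ (0≤+ (0≤* (0≤pos 243) (0≤i*i ε)) (0≤* (0≤pos 486) 0≤ε)) (0≤pos 207))))

  -- The flex with tangent of slope 3u and intercept m; (u , m) and (- u , - m) give the
  -- same curve, so u ≥ 0, and the label is u, or |m| when u = 0.
  data Shape (A B : ℤ) : Set where
    horizontal : (w : ℕ) → B ≡ + w * + w → Shape A B
    sloped : (w : ℕ) (m : ℤ) → let u = + suc w in
      A ≡ + 6 * u * m + + 27 * u * u * u * u →
      B ≡ m * m - + 27 * u * u * u * u * u * u → Shape A B

  kind : ∀ {A B} → Shape A B → Fin 2
  kind (horizontal _ _) = zero
  kind (sloped _ _ _ _) = suc zero

  label : ∀ {A B} → Shape A B → ℕ
  label (horizontal w _) = w
  label (sloped w _ _ _) = suc w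

  +n≤i⇒n≤∣i∣ : ∀ {n i} → + n ≤ i → n ℕ.≤ ∣ i ∣
  +n≤i⇒n≤∣i∣ (+≤+ n≤i) = n≤i

  -- In the horizontal case (w + e)² - w² ≥ e². In the sloped case A is fixed and B falls as u
  -- grows, by at least u′² - u² = e(e + 2u) ≥ e² according to `gap`.
  separated-at : ∀ {A B B′} (p : Shape A B) (p′ : Shape A B′) → kind p ≡ kind p′ →
    ∀ e → label p ℕ.+ e ≡ label p′ → e ℕ.* e ℕ.≤ ∣ B - B′ ∣
  separated-at p p′ _ zero _ = ℕ.z≤n
  separated-at {B = B} {B′} (horizontal w B≡) (horizontal v B′≡) _ e@(suc _) refl =
    subst (e ℕ.* e ℕ.≤_) (∣i-j∣≡∣j-i∣ B′ B) (+n≤i⇒n≤∣i∣ (≤-by (+ (2 ℕ.* e ℕ.* w)) (+≤+ ℕ.z≤n) (begin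
      B′ - B                                         ≡⟨ cong₂ _-_ B′≡ B≡ ⟩
      (+ w + + e) * (+ w + + e) - + w * + w          ≡⟨ solve 2 (λ w e → (w :+ e) :* (w :+ e) :- w :* w := e :* e :+ con (+ 2) :* e :* w) refl (+ w) (+ e) ⟩
      + e * + e + + 2 * + e * + w                    ≡⟨ cong₂ _+_ (sym (pos-* e e)) (sym (trans (pos-* (2 ℕ.* e) w) (cong (_* + w) (pos-* 2 e)))) ⟩
      + (e ℕ.* e) + + (2 ℕ.* e ℕ.* w)                ∎)))
    where open ≡-Reasoning
  separated-at {A} {B} {B′} (sloped w m A≡ B≡) (sloped v n A≡′ B′≡) _ e@(suc e′) eq =
    ℕₚ.≤-trans (ℕₚ.*-monoʳ-≤ e (ℕₚ.m≤m+n e (2 ℕ.* suc w)))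
      (+n≤i⇒n≤∣i∣ (subst (+ (e ℕ.* (e ℕ.+ 2 ℕ.* suc w)) ≤_) (sym (cong₂ _-_ (cubed u m B≡) (cubed u′ n B′≡)))
        -- `gap` takes the distance of the two squares in the form 1 + ε. Since `e` is a successor,
        -- so is e(e + 2u), and `ℕ.pred` supplies ε.
        (gap {u * u} {u′ * u′} {A} {ε = + ℕ.pred (e ℕ.* (e ℕ.+ 2 ℕ.* suc w))} (+≤+ ℕ.z≤n) squares
          (coefficient u m A≡) (coefficient u′ n A≡′))))
    where
    open ≡-Reasoning
    u = + suc w
    u′ = + suc v
    cubed : ∀ {B} u m → B ≡ m * m - + 27 * u * u * u * u * u * u →
      B ≡ m * m - + 27 * (u * u) * (u * u) * (u * u)
    cubed u m eq = trans eq (solve 2 (λ u m → m :* m :- con (+ 27) :* u :* u :* u :* u :* u :* u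
      := m :* m :- con (+ 27) :* (u :* u) :* (u :* u) :* (u :* u)) refl u m)
    coefficient : ∀ u m → A ≡ + 6 * u * m + + 27 * u * u * u * u →
      + 36 * (u * u) * (m * m) ≡ (A - + 27 * (u * u) * (u * u)) * (A - + 27 * (u * u) * (u * u))
    coefficient u m eq = trans
      (solve 2 (λ u m → let a = con (+ 6) :* u :* m :+ con (+ 27) :* u :* u :* u :* u :- con (+ 27) :* (u :* u) :* (u :* u) in
        con (+ 36) :* (u :* u) :* (m :* m) := a :* a) refl u m)
      (cong (λ A → (A - + 27 * (u * u) * (u * u)) * (A - + 27 * (u * u) * (u * u))) (sym eq))
    squares : u′ * u′ ≡ u * u + + (e ℕ.* (e ℕ.+ 2 ℕ.* suc w))
    squares = begin
      u′ * u′                              ≡⟨ cong (λ z → + z * + z) (sym eq) ⟩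
      (u + + e) * (u + + e)                ≡⟨ solve 2 (λ u e → (u :+ e) :* (u :+ e) := u :* u :+ e :* (e :+ con (+ 2) :* u)) refl u (+ e) ⟩
      u * u + + e * (+ e + + 2 * u)        ≡⟨ cong (λ z → u * u + + e * (+ e + z)) (sym (pos-* 2 (suc w))) ⟩
      u * u + + e * + (e ℕ.+ 2 ℕ.* suc w)  ≡⟨ cong (λ z → u * u + z) (sym (pos-* e _)) ⟩
      u * u + + (e ℕ.* (e ℕ.+ 2 ℕ.* suc w)) ∎

  separated : ∀ {A B B′} (p : Shape A B) (p′ : Shape A B′) → kind p ≡ kind p′ →
    ℕ.∣ label p - label p′ ∣ ℕ.* ℕ.∣ label p - label p′ ∣ ℕ.≤ ∣ B - B′ ∣
  separated {A} {B} {B′} p p′ k≡ with ℕₚ.≤-total (label p) (label p′)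
  ... | inj₁ le = separated-at p p′ k≡ _ (trans (cong (label p ℕ.+_) (ℕₚ.m≤n⇒∣m-n∣≡n∸m le)) (ℕₚ.m+[n∸m]≡n le))
  ... | inj₂ ge = subst₂ (λ d z → d ℕ.* d ℕ.≤ z) (ℕₚ.∣-∣-comm (label p′) (label p)) (∣i-j∣≡∣j-i∣ B′ B)
    (separated-at p′ p (sym k≡) _ (trans (cong (label p′ ℕ.+_) (ℕₚ.m≤n⇒∣m-n∣≡n∸m ge)) (ℕₚ.m+[n∸m]≡n ge)))

  -- In the sloped case A = 6um + 27u⁴ is linear in m with coefficient 6u ≠ 0, so A and u fix m,
  -- hence B.
  determined : ∀ {A B B′} (p : Shape A B) (p′ : Shape A B′) → kind p ≡ kind p′ → label p ≡ label p′ → B ≡ B′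
  determined (horizontal w B≡) (horizontal v B′≡) _ refl = trans B≡ (sym B′≡)
  determined (sloped w m A≡ B≡) (sloped v n A≡′ B′≡) _ refl =
    trans B≡ (trans (cong (λ m → m * m - + 27 * u * u * u * u * u * u) m≡n) (sym B′≡))
    where
    u = + suc w
    m≡n : m ≡ n
    m≡n = *-cancelˡ-≡ (+ 6 * u) m n (∙-cancelʳ (+ 27 * u * u * u * u) _ _ (trans (sym A≡) A≡′))

  HasFlex⇒Shape : ∀ {A B} → HasFlex A B → Shape A B
  HasFlex⇒Shape (hasFlex (+ zero) m A≡ B≡) = horizontal ∣ m ∣
    (trans B≡ (trans (+-identityʳ (m * m)) (trans (i*i≡∣i∣² m) (pos-* ∣ m ∣ ∣ m ∣))))
  HasFlex⇒Shape (hasFlex (+ suc w) m A≡ B≡) = sloped w m A≡ B≡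
  HasFlex⇒Shape (hasFlex -[1+ w ] m A≡ B≡) = sloped w (- m)
    (trans A≡ (solve 2 (λ u m → con (+ 6) :* (:- u) :* m :+ con (+ 27) :* (:- u) :* (:- u) :* (:- u) :* (:- u)
      := con (+ 6) :* u :* (:- m) :+ con (+ 27) :* u :* u :* u :* u) refl (+ suc w) m))
    (trans B≡ (solve 2 (λ u m → m :* m :- con (+ 27) :* (:- u) :* (:- u) :* (:- u) :* (:- u) :* (:- u) :* (:- u)
      := (:- m) :* (:- m) :- con (+ 27) :* u :* u :* u :* u :* u :* u) refl (+ suc w) m))

open Shapes using (Shape; kind; label; separated; determined; HasFlex⇒Shape)

open import Data.Rational
open import Data.Rational.Properties
open import Data.Rational.Solver using (module +-*-Solver)
import Data.Rational.Unnormalised as ℚᵘ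
import Data.Rational.Unnormalised.Properties as ℚᵘₚ
open import Algebra.Properties.CommutativeSemiring.Exp
  (CommutativeRing.commutativeSemiring +-*-commutativeRing)
  using (_^_; ^-homo-*; ^-assocʳ; ^-distrib-*)
open Rationals
open ℝ
open +-*-Solver using (solve; con; _:=_; _:+_; _:*_; _:-_; :-_)

-- From 3-torsion points to integral flexes

/1-+ : ∀ i j → (i ℤ.+ j) / 1 ≡ i / 1 + j / 1
/1-+ i j = toℚᵘ-injective (ℚᵘₚ.≃-trans (toℚᵘ-fromℚᵘ (ℚᵘ.mkℚᵘ (i ℤ.+ j) 0))
  (ℚᵘₚ.≃-sym (ℚᵘₚ.≃-trans (toℚᵘ-homo-+ (i / 1) (j / 1))
    (ℚᵘₚ.≃-trans (ℚᵘₚ.+-cong (toℚᵘ-fromℚᵘ (ℚᵘ.mkℚᵘ i 0)) (toℚᵘ-fromℚᵘ (ℚᵘ.mkℚᵘ j 0)))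
      (ℚᵘ.*≡* (cong (ℤ._* ℤ.+ 1) (cong₂ ℤ._+_ (ℤₚ.*-identityʳ i) (ℤₚ.*-identityʳ j))))))))

/1-* : ∀ i j → (i ℤ.* j) / 1 ≡ i / 1 * (j / 1)
/1-* i j = toℚᵘ-injective (ℚᵘₚ.≃-trans (toℚᵘ-fromℚᵘ (ℚᵘ.mkℚᵘ (i ℤ.* j) 0))
  (ℚᵘₚ.≃-sym (ℚᵘₚ.≃-trans (toℚᵘ-homo-* (i / 1) (j / 1))
    (ℚᵘₚ.*-cong (toℚᵘ-fromℚᵘ (ℚᵘ.mkℚᵘ i 0)) (toℚᵘ-fromℚᵘ (ℚᵘ.mkℚᵘ j 0))))))

/1-injective : ∀ {i j} → i / 1 ≡ j / 1 → i ≡ j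
/1-injective {i} {j} eq = trans (sym (ℤₚ.*-identityʳ i)) (trans (ℚᵘₚ.drop-*≡* (ℚᵘₚ.≃-trans
  (ℚᵘₚ.≃-sym (toℚᵘ-fromℚᵘ (ℚᵘ.mkℚᵘ i 0))) (ℚᵘₚ.≃-trans (toℚᵘ-cong eq) (toℚᵘ-fromℚᵘ (ℚᵘ.mkℚᵘ j 0)))))
  (ℤₚ.*-identityʳ j))

infix 4 _↦_
infixl 6 _⊞_
infixl 7 _⊠_

-- A record, unlike the bare equation, lets unification recover i and q.
record _↦_ (i : ℤ) (q : ℚ) : Set where
  constructor embed
  field image : i / 1 ≡ q

open _↦_

-- A term in `⊞`, `⊠` and `⟦_⟧` mirrors an integer polynomial; its `image` carries the whole
-- polynomial to ℚ at once.
_⊞_ : ∀ {i j p q} → i ↦ p → j ↦ q → i ℤ.+ j ↦ p + q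
_⊞_ {i} {j} (embed i↦p) (embed j↦q) = embed (trans (/1-+ i j) (cong₂ _+_ i↦p j↦q))

_⊠_ : ∀ {i j p q} → i ↦ p → j ↦ q → i ℤ.* j ↦ p * q
_⊠_ {i} {j} (embed i↦p) (embed j↦q) = embed (trans (/1-* i j) (cong₂ _*_ i↦p j↦q))

⟦_⟧ : ∀ i → i ↦ i / 1
⟦ i ⟧ = embed refl

coprime-∣-power⇒≡1 : ∀ {d n} k → Coprime d n → d ∣ n ℕ.^ k → d ≡ 1
coprime-∣-power⇒≡1 zero    c d∣1 = ∣1⇒≡1 d∣1
coprime-∣-power⇒≡1 (suc k) c d∣n^ = coprime-∣-power⇒≡1 k c (coprime-divisor c d∣n^)

prime-∣-power : ∀ {p n} → Prime p → ∀ k → p ∣ n ℕ.^ suc k → p ∣ n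
prime-∣-power {p} {n} pr zero    p∣ = subst (p ∣_) (ℕₚ.*-identityʳ n) p∣
prime-∣-power {p} {n} pr (suc k) p∣ = [ id , prime-∣-power pr k ]′ (euclidsLemma n (n ℕ.^ suc k) pr p∣)

abs-⁴ : ∀ p → ℤ.∣ p ℤ.* p ℤ.* p ℤ.* p ∣ ≡ ℤ.∣ p ∣ ℕ.^ 4
abs-⁴ p = trans (ℤₚ.abs-* (p ℤ.* p ℤ.* p) p) (trans (cong (ℕ._* ℤ.∣ p ∣)
  (trans (ℤₚ.abs-* (p ℤ.* p) p) (cong (ℕ._* ℤ.∣ p ∣) (ℤₚ.abs-* p p))))
  (ℕ-solve 1 (λ n → n ℕ:* n ℕ:* n ℕ:* n ℕ:= n ℕ:* (n ℕ:* (n ℕ:* (n ℕ:* ℕcon 1)))) refl ℤ.∣ p ∣))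

-- The rational root theorem: multiplying by d⁴ for q = p / d shows that d divides p⁴, and d is
-- coprime to p, so d = 1. There is no cubic term, as in the 3-division polynomial.
monic-quartic-root : ∀ q (a b c : ℤ) → q * q * q * q ≡ a / 1 * (q * q) + b / 1 * q + c / 1 → q ≡ ↥ q / 1
monic-quartic-root q@(mkℚ p d-1 cop) a b c eq = begin
  q                        ≡⟨ sym (*-identityʳ q) ⟩
  q * 1ℚ                   ≡⟨ cong (λ n → q * ι n) (sym d≡1) ⟩
  q * ι (suc d-1)          ≡⟨ q*d ⟩
  p / 1                    ∎
  where
  open ≡-Reasoning
  d = ℤ.+ suc d-1
  D = d / 1
  q*d : q * D ≡ p / 1
  q*d = trans (cong (_* D) (sym (↥p/↧p≡p q))) (/-* p d-1)
  cofactor = a ℤ.* p ℤ.* p ℤ.* d ℤ.+ b ℤ.* p ℤ.* d ℤ.* d ℤ.+ c ℤ.* d ℤ.* d ℤ.* d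
  P : p ↦ q * D
  P = embed (sym q*d)
  p⁴ : p ℤ.* p ℤ.* p ℤ.* p ≡ d ℤ.* cofactor
  p⁴ = /1-injective (begin
    (p ℤ.* p ℤ.* p ℤ.* p) / 1
      ≡⟨ image (P ⊠ P ⊠ P ⊠ P) ⟩
    (q * D) * (q * D) * (q * D) * (q * D)
      ≡⟨ solve 2 (λ q D → q :* D :* (q :* D) :* (q :* D) :* (q :* D) := q :* q :* q :* q :* (D :* D :* D :* D)) refl q D ⟩
    q * q * q * q * (D * D * D * D)
      ≡⟨ cong (_* (D * D * D * D)) eq ⟩
    (a / 1 * (q * q) + b / 1 * q + c / 1) * (D * D * D * D)
      ≡⟨ solve 5 (λ q D a b c → (a :* (q :* q) :+ b :* q :+ c) :* (D :* D :* D :* D)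
           := D :* (a :* (q :* D) :* (q :* D) :* D :+ b :* (q :* D) :* D :* D :+ c :* D :* D :* D)) refl q D (a / 1) (b / 1) (c / 1) ⟩
    D * (a / 1 * (q * D) * (q * D) * D + b / 1 * (q * D) * D * D + c / 1 * D * D * D)
      ≡⟨ sym (image (⟦ d ⟧ ⊠ (⟦ a ⟧ ⊠ P ⊠ P ⊠ ⟦ d ⟧ ⊞ ⟦ b ⟧ ⊠ P ⊠ ⟦ d ⟧ ⊠ ⟦ d ⟧ ⊞ ⟦ c ⟧ ⊠ ⟦ d ⟧ ⊠ ⟦ d ⟧ ⊠ ⟦ d ⟧))) ⟩
    (d ℤ.* cofactor) / 1 ∎)
  d∣p⁴ : suc d-1 ∣ ℤ.∣ p ∣ ℕ.^ 4
  d∣p⁴ = subst (suc d-1 ∣_) (trans (sym (ℤₚ.abs-* d cofactor)) (trans (cong ℤ.∣_∣ (sym p⁴)) (abs-⁴ p)))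
    (m∣m*n ℤ.∣ cofactor ∣)
  d≡1 : suc d-1 ≡ 1
  -- The coprimality stored in a rational is irrelevant, so the equality is recovered from its
  -- decidability.
  d≡1 = recompute (suc d-1 ℕ.≟ 1) (coprime-∣-power⇒≡1 4 (Coprimality.sym cop) d∣p⁴)

-- The coefficients of X³ + a X + b - (l X + m)² = (X - x)³, where Y = l X + m is the tangent at the
-- flex of abscissa x.
record Flex (a b : ℚ) : Set where
  constructor flex
  field
    l x m : ℚ
    l²    : l * l ≡ x + x + x
    a≡    : a ≡ l * m + l * m + (x * x + x * x + x * x)
    b≡    : b ≡ m * m - x * x * x

module _ {a b : ℚ} where
  open ChordTangent {a} {b}

  sum≡𝒪⇒same-x : ∀ x₁ y₁ x₂ y₂ e₁ e₂ d₁ d₂ → add-affine x₁ y₁ x₂ y₂ e₁ e₂ d₁ d₂ ≡ 𝒪 → x₁ ≡ x₂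
  sum≡𝒪⇒same-x _ _ _ _ _ _ (yes eq) _ _ = eq
  sum≡𝒪⇒same-x _ _ _ _ _ _ (no _) _ ()

  -- The two decisions are arguments so that 2P reduces by matching on them. If 2P = 𝒪, then 3P = P
  -- is affine, a contradiction. Otherwise 2P + P = 𝒪 forces 2P and P to share their abscissa, so l²
  -- - 2x = x and the tangent meets the curve only at P.
  tripled : ∀ x y e d₁ d₂ → add-affine x y x y e e d₁ d₂ ⊕ affine x y e ≡ 𝒪 → Flex a b
  tripled x y e (no x≢x) _ _ = ⊥-elim (x≢x refl)
  tripled x y e (yes _) (yes _) ()
  tripled x y e (yes x≡x) (no 2y≢0) sum≡𝒪 = inflection (tangent x y 2y≢0) tangent-slope (sum≡𝒪⇒same-x _ _ _ _ _ _ _ _ sum≡𝒪)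
    where
    tangent-slope : tangent x y 2y≢0 * (y + y) ≡ x * x + x * x + x * x + a
    tangent-slope = ÷-* _ (y + y) {{≢-nonZero 2y≢0}}
    inflection : ∀ l → l * (y + y) ≡ x * x + x * x + x * x + a → x₃ x x l ≡ x → Flex a b
    inflection l slope x₃≡x = flex l x m l²≡ a≡ b≡
      where
      open ≡-Reasoning
      m = y - l * x
      l²≡ : l * l ≡ x + x + x
      l²≡ = trans (solve 2 (λ l x → l :* l := (l :* l :- x :- x) :+ x :+ x) refl l x)
                  (cong (λ z → z + x + x) x₃≡x)
      a≡ : a ≡ l * m + l * m + (x * x + x * x + x * x)
      a≡ = begin
        a
          ≡⟨ solve 2 (λ a x → a := (x :* x :+ x :* x :+ x :* x :+ a) :- con (ι 3) :* x :* x) refl a x ⟩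
        (x * x + x * x + x * x + a) - ι 3 * x * x
          ≡⟨ cong (_- ι 3 * x * x) (sym slope) ⟩
        l * (y + y) - ι 3 * x * x
          ≡⟨ solve 3 (λ l x y → l :* (y :+ y) :- con (ι 3) :* x :* x
               := con (ι 2) :* l :* (y :- l :* x) :+ con (ι 2) :* x :* (l :* l) :- con (ι 3) :* x :* x) refl l x y ⟩
        ι 2 * l * m + ι 2 * x * (l * l) - ι 3 * x * x
          ≡⟨ cong (λ z → ι 2 * l * m + ι 2 * x * z - ι 3 * x * x) l²≡ ⟩
        ι 2 * l * m + ι 2 * x * (x + x + x) - ι 3 * x * x
          ≡⟨ solve 3 (λ l m x → con (ι 2) :* l :* m :+ con (ι 2) :* x :* (x :+ x :+ x) :- con (ι 3) :* x :* x
               := l :* m :+ l :* m :+ (x :* x :+ x :* x :+ x :* x)) refl l m x ⟩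
        l * m + l * m + (x * x + x * x + x * x) ∎
      b≡ : b ≡ m * m - x * x * x
      b≡ = begin
        b
          ≡⟨ solve 3 (λ a b x → b := (x :* x :* x :+ a :* x :+ b) :- x :* x :* x :- a :* x) refl a b x ⟩
        (x * x * x + a * x + b) - x * x * x - a * x
          ≡⟨ cong₂ (λ z a → z - x * x * x - a * x) (sym e) a≡ ⟩
        y * y - x * x * x - (l * m + l * m + (x * x + x * x + x * x)) * x
          ≡⟨ solve 3 (λ l x y → let m = y :- l :* x in
               y :* y :- x :* x :* x :- (l :* m :+ l :* m :+ (x :* x :+ x :* x :+ x :* x)) :* x
               := m :* m :+ l :* l :* x :* x :- con (ι 4) :* x :* x :* x) refl l x y ⟩
        m * m + l * l * x * x - ι 4 * x * x * x
          ≡⟨ cong (λ z → m * m + z * x * x - ι 4 * x * x * x) l²≡ ⟩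
        m * m + (x + x + x) * x * x - ι 4 * x * x * x
          ≡⟨ solve 2 (λ m x → m :* m :+ (x :+ x :+ x) :* x :* x :- con (ι 4) :* x :* x :* x
               := m :* m :- x :* x :* x) refl m x ⟩
        m * m - x * x * x ∎

  3-torsion⇒flex : (P : Point a b) → 3-Torsion P → P ≢ 𝒪 → Flex a b
  3-torsion⇒flex 𝒪 _ P≢𝒪 = ⊥-elim (P≢𝒪 refl)
  3-torsion⇒flex (affine x y e) 3P≡𝒪 _ = tripled x y e (x ≟ x) (y + y ≟ 0ℚ) 3P≡𝒪

3-prime : Prime 3
3-prime = from-yes (prime? 3)

-- X = 3x is a root of a monic integral quartic (the 3-division polynomial), and
-- l and m are then square roots of integers, so all three are integers.  The
-- quartic also shows that 3 divides X, hence l; u is l / 3.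
integral-flex : ∀ {A B} → Flex (A / 1) (B / 1) → HasFlex A B
integral-flex {A} {B} (flex l x m l² a≡ b≡) = divided (∣ᵤ⇒∣ 3∣l)
  where
  open ≡-Reasoning
  a = A / 1
  b = B / 1
  X = x + x + x
  quartic : X * X * X * X ≡ - ι 18 * a * (X * X) + - ι 108 * b * X + ι 27 * a * a
  quartic = begin
    X * X * X * X
      -- This is 27 times the 3-division polynomial 3x⁴ + 6ax² + 12bx - a² rewritten in X. After a
      -- and b are expressed by l, m and x, the two sides differ by 108m²(X - l²), which vanishes.
      ≡⟨ solve 3 (λ x l m → let X = x :+ x :+ x
                                a = l :* m :+ l :* m :+ (x :* x :+ x :* x :+ x :* x)
                                b = m :* m :- x :* x :* x in
           X :* X :* X :* X := con (- ι 18) :* a :* (X :* X) :+ con (- ι 108) :* b :* X :+ con (ι 27) :* a :* a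
             :+ (X :- l :* l) :* con (ι 108) :* m :* m)
           refl x l m ⟩
    - ι 18 * a′ * (X * X) + - ι 108 * b′ * X + ι 27 * a′ * a′ + (X - l * l) * ι 108 * m * m
      ≡⟨ cong (λ z → - ι 18 * a′ * (X * X) + - ι 108 * b′ * X + ι 27 * a′ * a′ + (X - z) * ι 108 * m * m) l² ⟩
    - ι 18 * a′ * (X * X) + - ι 108 * b′ * X + ι 27 * a′ * a′ + (X - X) * ι 108 * m * m
      ≡⟨ solve 3 (λ c X m → c :+ (X :- X) :* con (ι 108) :* m :* m := c) refl _ X m ⟩
    - ι 18 * a′ * (X * X) + - ι 108 * b′ * X + ι 27 * a′ * a′
      ≡⟨ cong₂ (λ a b → - ι 18 * a * (X * X) + - ι 108 * b * X + ι 27 * a * a) (sym a≡) (sym b≡) ⟩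
    - ι 18 * a * (X * X) + - ι 108 * b * X + ι 27 * a * a ∎
    where
    a′ = l * m + l * m + (x * x + x * x + x * x)
    b′ = m * m - x * x * x
  X-integer : X ≡ ↥ X / 1
  X-integer = monic-quartic-root X (-[1+ 17 ] ℤ.* A) (-[1+ 107 ] ℤ.* B) (ℤ.+ 27 ℤ.* A ℤ.* A)
    (trans quartic (cong₂ _+_ (cong₂ _+_
      (cong (_* (X * X)) (sym (/1-* -[1+ 17 ] A))) (cong (_* X) (sym (/1-* -[1+ 107 ] B))))
      (sym (image (⟦ ℤ.+ 27 ⟧ ⊠ ⟦ A ⟧ ⊠ ⟦ A ⟧)))))
  ↥X : ↥ X ↦ X
  ↥X = embed (sym X-integer)
  square-root : ∀ z c → z * z ≡ c / 1 → z ≡ ↥ z / 1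
  -- Squaring z² = c gives z⁴ = c², a quartic whose lower coefficients are zero except the constant
  -- one.
  square-root z c z² = monic-quartic-root z ℤ.0ℤ ℤ.0ℤ (c ℤ.* c) (begin
    z * z * z * z                         ≡⟨ *-assoc (z * z) z z ⟩
    z * z * (z * z)                       ≡⟨ cong₂ _*_ z² z² ⟩
    c / 1 * (c / 1)                       ≡⟨ sym (/1-* c c) ⟩
    (c ℤ.* c) / 1                         ≡⟨ solve 2 (λ c z → c := con 0ℚ :* (z :* z) :+ con 0ℚ :* z :+ c) refl _ z ⟩
    0ℚ * (z * z) + 0ℚ * z + (c ℤ.* c) / 1 ∎)
  ↥l : ↥ l ↦ l
  ↥l = embed (sym (square-root l (↥ X) (trans l² X-integer)))
  -- A third of the right-hand side of `quartic`, whose coefficients 18, 108 and 27 are all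
  -- divisible by 3.
  k = -[1+ 5 ] ℤ.* A ℤ.* (↥ X ℤ.* ↥ X) ℤ.+ -[1+ 35 ] ℤ.* B ℤ.* ↥ X ℤ.+ ℤ.+ 9 ℤ.* A ℤ.* A
  X⁴≡3k : ↥ X ℤ.* ↥ X ℤ.* ↥ X ℤ.* ↥ X ≡ ℤ.+ 3 ℤ.* k
  X⁴≡3k = /1-injective (begin
    (↥ X ℤ.* ↥ X ℤ.* ↥ X ℤ.* ↥ X) / 1
      ≡⟨ image (↥X ⊠ ↥X ⊠ ↥X ⊠ ↥X) ⟩
    X * X * X * X
      ≡⟨ quartic ⟩
    - ι 18 * a * (X * X) + - ι 108 * b * X + ι 27 * a * a
      ≡⟨ solve 3 (λ a b X → con (- ι 18) :* a :* (X :* X) :+ con (- ι 108) :* b :* X :+ con (ι 27) :* a :* a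
           := con (ι 3) :* (con (- ι 6) :* a :* (X :* X) :+ con (- ι 36) :* b :* X :+ con (ι 9) :* a :* a)) refl a b X ⟩
    ι 3 * (- ι 6 * a * (X * X) + - ι 36 * b * X + ι 9 * a * a)
      ≡⟨ sym (image (⟦ ℤ.+ 3 ⟧ ⊠ (⟦ -[1+ 5 ] ⟧ ⊠ ⟦ A ⟧ ⊠ (↥X ⊠ ↥X) ⊞ ⟦ -[1+ 35 ] ⟧ ⊠ ⟦ B ⟧ ⊠ ↥X
          ⊞ ⟦ ℤ.+ 9 ⟧ ⊠ ⟦ A ⟧ ⊠ ⟦ A ⟧))) ⟩
    (ℤ.+ 3 ℤ.* k) / 1 ∎)
  3∣X : 3 ∣ ℤ.∣ ↥ X ∣
  3∣X = prime-∣-power 3-prime 3 (subst (3 ∣_)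
    (trans (sym (ℤₚ.abs-* (ℤ.+ 3) k)) (trans (cong ℤ.∣_∣ (sym X⁴≡3k)) (abs-⁴ (↥ X)))) (m∣m*n ℤ.∣ k ∣))
  l²≡X : ↥ l ℤ.* ↥ l ≡ ↥ X
  l²≡X = /1-injective (trans (image (↥l ⊠ ↥l)) (trans l² X-integer))
  3∣l : 3 ∣ ℤ.∣ ↥ l ∣
  3∣l = [ id , id ]′ (euclidsLemma ℤ.∣ ↥ l ∣ ℤ.∣ ↥ l ∣ 3-prime
    (subst (3 ∣_) (trans (cong ℤ.∣_∣ (sym l²≡X)) (ℤₚ.abs-* (↥ l) (↥ l))) 3∣X))
  divided : ℤ.+ 3 Signed.∣ ↥ l → HasFlex A B
  divided (Signed.divides u l≡u*3) = hasFlex u (↥ m)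
      (/1-injective (begin
        A / 1
          ≡⟨ a≡ ⟩
        l * m + l * m + (x * x + x * x + x * x)
          ≡⟨ cong₂ (λ l x → l * m + l * m + (x * x + x * x + x * x)) l≡ x≡ ⟩
        u′ * ι 3 * m + u′ * ι 3 * m + (ι 3 * u′ * u′ * (ι 3 * u′ * u′) + ι 3 * u′ * u′ * (ι 3 * u′ * u′) + ι 3 * u′ * u′ * (ι 3 * u′ * u′))
          ≡⟨ solve 2 (λ u m → let x = con (ι 3) :* u :* u in
               u :* con (ι 3) :* m :+ u :* con (ι 3) :* m :+ (x :* x :+ x :* x :+ x :* x)
               := con (ι 6) :* u :* m :+ con (ι 27) :* u :* u :* u :* u) refl u′ m ⟩
        ι 6 * u′ * m + ι 27 * u′ * u′ * u′ * u′
          ≡⟨ sym (image (⟦ ℤ.+ 6 ⟧ ⊠ ⟦ u ⟧ ⊠ ↥m ⊞ 27u⁴)) ⟩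
        (ℤ.+ 6 ℤ.* u ℤ.* ↥ m ℤ.+ ℤ.+ 27 ℤ.* u ℤ.* u ℤ.* u ℤ.* u) / 1 ∎))
      (begin
        B                                       ≡⟨ sym (ℤₚ.+-identityʳ B) ⟩
        B ℤ.+ ℤ.0ℤ                              ≡⟨ cong (λ z → B ℤ.+ z) (sym (ℤₚ.+-inverseʳ N)) ⟩
        B ℤ.+ (N ℤ.- N)                         ≡⟨ sym (ℤₚ.+-assoc B N (ℤ.- N)) ⟩
        B ℤ.+ N ℤ.- N                           ≡⟨ cong (ℤ._- N) (sym ↥m²) ⟩
        ↥ m ℤ.* ↥ m ℤ.- N                       ∎)
    where
    u′ = u / 1
    N = ℤ.+ 27 ℤ.* u ℤ.* u ℤ.* u ℤ.* u ℤ.* u ℤ.* u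
    27u⁴ = ⟦ ℤ.+ 27 ⟧ ⊠ ⟦ u ⟧ ⊠ ⟦ u ⟧ ⊠ ⟦ u ⟧ ⊠ ⟦ u ⟧
    27u⁶ = 27u⁴ ⊠ ⟦ u ⟧ ⊠ ⟦ u ⟧
    l≡ : l ≡ u′ * ι 3
    l≡ = trans (sym (image ↥l)) (trans (cong (_/ 1) l≡u*3) (/1-* u (ℤ.+ 3)))
    x≡ : x ≡ ι 3 * u′ * u′
    x≡ = begin
      x                                ≡⟨ solve 1 (λ x → x := (x :+ x :+ x) :* con (ℤ.+ 1 / 3)) refl x ⟩
      X * (ℤ.+ 1 / 3)                  ≡⟨ cong (_* (ℤ.+ 1 / 3)) (trans (sym l²) (cong₂ _*_ l≡ l≡)) ⟩
      u′ * ι 3 * (u′ * ι 3) * (ℤ.+ 1 / 3) ≡⟨ solve 1 (λ u → u :* con (ι 3) :* (u :* con (ι 3)) :* con (ℤ.+ 1 / 3) := con (ι 3) :* u :* u) refl u′ ⟩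
      ι 3 * u′ * u′                    ∎
    -- Since x = l² / 3 = 3u² is an integer, m² = b + x³ is one too.
    m² : m * m ≡ (B ℤ.+ N) / 1
    m² = begin
      m * m
        ≡⟨ solve 2 (λ m x → m :* m := (m :* m :- x :* x :* x) :+ x :* x :* x) refl m x ⟩
      (m * m - x * x * x) + x * x * x
        ≡⟨ cong₂ (λ b x → b + x * x * x) (sym b≡) x≡ ⟩
      b + ι 3 * u′ * u′ * (ι 3 * u′ * u′) * (ι 3 * u′ * u′)
        ≡⟨ cong (b +_) (solve 1 (λ u → let x = con (ι 3) :* u :* u in
             x :* x :* x := con (ι 27) :* u :* u :* u :* u :* u :* u) refl u′) ⟩
      b + ι 27 * u′ * u′ * u′ * u′ * u′ * u′
        ≡⟨ sym (image (⟦ B ⟧ ⊞ 27u⁶)) ⟩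
      (B ℤ.+ N) / 1 ∎
    ↥m : ↥ m ↦ m
    ↥m = embed (sym (square-root m (B ℤ.+ N) m²))
    ↥m² : ↥ m ℤ.* ↥ m ≡ B ℤ.+ N
    ↥m² = /1-injective (trans (image (↥m ⊠ ↥m)) m²)

-- Real powers

*-cancelʳ-≡ : ∀ {p q} r → 0ℚ < r → p * r ≡ q * r → p ≡ q
*-cancelʳ-≡ r 0<r eq = ≤-antisym (*-cancel-≤ r 0<r (≤-reflexive eq))
                                 (*-cancel-≤ r 0<r (≤-reflexive (sym eq)))

U⇒≤ : ∀ {p y u} → fromℚ p ≤ᴿ y → U y u → p ≤ u
U⇒≤ {y = y} p≤y Uu = ≮⇒≥ λ u<p → disjoint y (p≤y _ u<p) Uu

-- If q + p′ < p ≤ M + N, then q + p′ < l₁ + l₂ for some l₁ < M and l₂ < N. As l₁ < p′, the bound q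
-- < l₂ remains.
difference-≤ : ∀ {M N p p′} → M ≤ᴿ fromℚ p′ → fromℚ p ≤ᴿ M +ᴿ N → fromℚ (p - p′) ≤ᴿ N
difference-≤ {M} {N} {p} {p′} M≤p′ p≤M+N q q<p-p′ =
  let (l₁ , l₂ , L₁ , L₂ , lt) = p≤M+N (q + p′) (subst (q + p′ <_)
        (solve 2 (λ p p′ → (p :- p′) :+ p′ := p) refl p p′) (+-monoˡ-< p′ q<p-p′))
      l₁<p′ = M≤p′ l₁ L₁
  in L-closed N (<-by ((l₁ + l₂ - (q + p′)) + (p′ - l₁)) (0<+ (0<- lt) (0<- l₁<p′))
       (solve 4 (λ q p l₁ l₂ → l₂ := q :+ ((l₁ :+ l₂ :- (q :+ p)) :+ (p :- l₁))) refl q p′ l₁ l₂)) L₂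

-- By locatedness it is enough to exclude an upper bound q′ < K p of the product. Its enclosing box
-- contains (K, b′) with b′ ≥ p, so its largest corner value is at least K p.
scale-≤ : ∀ {K p y} → 0ℚ < K → fromℚ p ≤ᴿ y → fromℚ (K * p) ≤ᴿ fromℚ K *ᴿ y
scale-≤ {K} {p} {y} 0<K p≤y q q<Kp = let (q′ , q<q′ , q′<Kp) = <-dense q<Kp in
  [ id , (λ Uq′ → ⊥-elim (<-asym q′<Kp (upper Uq′))) ]′ (located (fromℚ K *ᴿ y) q<q′)
  where
  upper : ∀ {q′} → U (fromℚ K *ᴿ y) q′ → K * p < q′
  upper (a , a′ , b , b′ , a<K , K<a′ , Lb , Ub , hi<q′) = ≤-<-trans
    (≤-trans (*-mono-≤ˡ K (<⇒≤ 0<K) (U⇒≤ {p} {y} p≤y Ub))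
      (Products.≤hi (<⇒≤ a<K) (<⇒≤ K<a′) (<⇒≤ (L<U y Lb Ub)) ≤-refl))
    hi<q′

≤ᴿ-weaken : ∀ {p q y} → p ≤ q → fromℚ q ≤ᴿ y → fromℚ p ≤ᴿ y
≤ᴿ-weaken p≤q q≤y r r<p = q≤y r (<-≤-trans r<p p≤q)

⅓ : ℚ
⅓ = ℤ.+ 1 / 3

-- A stand-in for rounding up: the grid of mesh 1 places y strictly between n - 2 and n. If n ≤ 3,
-- then n / 3 ≤ 1 ≤ y; if n ≥ 3, then n / 3 ≤ n - 2.
ℕ-above : ∀ {y} → 1ᴿ ≤ᴿ y →
  ∃[ n ] ((∀ d → fromℕ d ≤ᴿ y → d ℕ.< n) × fromℚ (ι n * ⅓) ≤ᴿ y)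
ℕ-above {y} 1≤y = let (m , k , Lm , Um) = grid y 0 in go m k Lm Um
  where
  go : ∀ m k → L y (frac m k 0) → U y (frac (suc (suc m)) k 0) →
    ∃[ n ] ((∀ d → fromℕ d ≤ᴿ y → d ℕ.< n) × fromℚ (ι n * ⅓) ≤ᴿ y)
  go m k Lm Um = n , bounds , below-third
    where
    n = suc (suc m) ℕ.∸ k
    -- The grid point m + 2 - k lies above y ≥ 1, so the truncated subtraction in `n` is exact.
    ιk≤ : ι k ≤ ι (suc (suc m))
    ιk≤ = ≤-by u (≤-trans (<⇒≤ 0<1) (U⇒≤ {1ℚ} {y} 1≤y Um))
      (trans (solve 2 (λ a b → a := b :+ (a :- b)) refl (ι (suc (suc m))) (ι k))
             (cong (ι k +_) (sym (ι-⊖ (suc (suc m)) k))))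
      where u = frac (suc (suc m)) k 0
    ιn≡ : ι n ≡ frac (suc (suc m)) k 0
    ιn≡ = cong (_/ 1) (sym (ℤₚ.⊖-≥ (ι-cancel-≤ {k} {suc (suc m)} ιk≤)))
    step : frac m k 0 ≡ ι n - ι 2
    step = begin
      frac m k 0                       ≡⟨ ι-⊖ m k ⟩
      ι m - ι k                        ≡⟨ solve 2 (λ a b → a :- b := con (ι 2) :+ a :- b :- con (ι 2)) refl (ι m) (ι k) ⟩
      ι 2 + ι m - ι k - ι 2            ≡⟨ cong (λ z → z - ι k - ι 2) (sym (ι-+ 2 m)) ⟩
      ι (suc (suc m)) - ι k - ι 2      ≡⟨ cong (_- ι 2) (sym (ι-⊖ (suc (suc m)) k)) ⟩
      frac (suc (suc m)) k 0 - ι 2     ≡⟨ cong (_- ι 2) (sym ιn≡) ⟩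
      ι n - ι 2                        ∎
      where open ≡-Reasoning
    bounds : ∀ d → fromℕ d ≤ᴿ y → d ℕ.< n
    bounds d d≤y = ℕₚ.≰⇒> λ n≤d → let (u , u< , Uu) = U-open y Um in
      <-irrefl refl (≤-<-trans (ι-mono {n} {d} n≤d) (≤-<-trans (U⇒≤ {ι d} {y} d≤y Uu) (subst (u <_) (sym ιn≡) u<)))
    below-third : fromℚ (ι n * ⅓) ≤ᴿ y
    below-third with ℕₚ.≤-total n 3
    ... | inj₁ n≤3 = ≤ᴿ-weaken {ι n * ⅓} {1ℚ} {y} (*-monoʳ-≤-nonNeg ⅓ (ι-mono {n} {3} n≤3)) 1≤y
    ... | inj₂ 3≤n = λ q q< → L-closed y (<-≤-trans q< (≤-by ((ι n - ι 3) * (ι 2 * ⅓))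
            (0≤* (0≤- (ι-mono {3} {n} 3≤n)) (nonNegative⁻¹ (ι 2 * ⅓)))
            (solve 1 (λ n → n :- con (ι 2) := n :* con ⅓ :+ (n :- con (ι 3)) :* con (ι 2 * ⅓)) refl (ι n))))
            (subst (L y) step Lm)

1≤power : ∀ {J} (1≤J : 1ᴿ ≤ᴿ J) {b} → L b 0ℚ → 1ᴿ ≤ᴿ J ^⟨ 1≤J ⟩ b
1≤power {J} 1≤J L0 q q<1 = let (t , Ut) = U-inhabited J in
  -- The rational exponent 0 lies below b, and J⁰ = 1.
  below 0 0 0 ½ t 1ℚ L0 (positive⁻¹ ½) (1≤J ½ (<-by ½ (positive⁻¹ ½) refl)) Ut (<⇒≤ 0<1) q<1 ≤-refl

-- The exponent r + r′ / 2 over the common denominator 2NN′, in the format that `BelowPower`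
-- records; `ℕ.pred` appears because `frac` takes the denominator minus one.
frac-half : ∀ m k n m′ k′ n′ →
  frac (m ℕ.* (suc n′ ℕ.* 2) ℕ.+ m′ ℕ.* suc n) (k ℕ.* (suc n′ ℕ.* 2) ℕ.+ k′ ℕ.* suc n)
       (ℕ.pred (suc n ℕ.* (suc n′ ℕ.* 2)))
  ≡ frac m k n + ½ * frac m′ k′ n′
frac-half m k n m′ k′ n′ = *-cancelʳ-≡ D (0<ι (ℕ.pred (suc n ℕ.* (suc n′ ℕ.* 2)))) (begin
  frac M K (ℕ.pred (suc n ℕ.* (suc n′ ℕ.* 2))) * D
    ≡⟨ frac-* M K (ℕ.pred (suc n ℕ.* (suc n′ ℕ.* 2))) ⟩
  ι M - ι K
    ≡⟨ cong₂ _-_ (lin m m′) (lin k k′) ⟩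
  (ι m * (N′ * ι 2) + ι m′ * N) - (ι k * (N′ * ι 2) + ι k′ * N)
    ≡⟨ solve 6 (λ m k m′ k′ N N′ → (m :* (N′ :* con (ι 2)) :+ m′ :* N) :- (k :* (N′ :* con (ι 2)) :+ k′ :* N)
         := (m :- k) :* N′ :* con (ι 2) :+ (m′ :- k′) :* N) refl (ι m) (ι k) (ι m′) (ι k′) N N′ ⟩
  (ι m - ι k) * N′ * ι 2 + (ι m′ - ι k′) * N
    ≡⟨ cong₂ (λ u v → u * N′ * ι 2 + v * N) (sym (frac-* m k n)) (sym (frac-* m′ k′ n′)) ⟩
  r * N * N′ * ι 2 + r′ * N′ * N
    ≡⟨ solve 4 (λ r r′ N N′ → r :* N :* N′ :* con (ι 2) :+ r′ :* N′ :* N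
         := (r :+ con ½ :* r′) :* (N :* (N′ :* con (ι 2)))) refl r r′ N N′ ⟩
  (r + ½ * r′) * (N * (N′ * ι 2))
    ≡⟨ cong ((r + ½ * r′) *_) (sym (trans (ι-* (suc n) (suc n′ ℕ.* 2)) (cong (N *_) (ι-* (suc n′) 2)))) ⟩
  (r + ½ * r′) * D ∎)
  where
  open ≡-Reasoning
  M = m ℕ.* (suc n′ ℕ.* 2) ℕ.+ m′ ℕ.* suc n
  K = k ℕ.* (suc n′ ℕ.* 2) ℕ.+ k′ ℕ.* suc n
  D = ι (suc n ℕ.* (suc n′ ℕ.* 2))
  N = ι (suc n)
  N′ = ι (suc n′)
  r = frac m k n
  r′ = frac m′ k′ n′
  lin : ∀ m m′ → ι (m ℕ.* (suc n′ ℕ.* 2) ℕ.+ m′ ℕ.* suc n) ≡ ι m * (N′ * ι 2) + ι m′ * N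
  lin m m′ = trans (ι-+ (m ℕ.* (suc n′ ℕ.* 2)) (m′ ℕ.* suc n)) (cong₂ _+_
    (trans (ι-* m (suc n′ ℕ.* 2)) (cong (ι m *_) (ι-* (suc n′) 2))) (ι-* m′ (suc n)))

-- The first hypothesis says b + c / 2 ≤ e in terms of lower cuts. Raising the root-free bound for p
-- to the power 2N′ and the one for q² to the power N makes q² into q to the power 2NN′; the product
-- of the two is the bound for pq, with no square root taken.
power-product : ∀ {x b c e p q} → (∀ {r₁ r₂} → L b r₁ → L c r₂ → L e (r₁ + ½ * r₂)) →
  0ℚ < p → 0ℚ < q → BelowPower x b p → BelowPower x c (q * q) → BelowPower x e (p * q)
power-product {x} {b} {c} {e} {p} {q} le 0<p 0<q
  (below m k n s t v Lb 0<s Ls Ut 0≤v p<v v≤) (below m′ k′ n′ s′ t′ v′ Lc 0<s′ Ls′ Ut′ 0≤v′ q²<v′ v′≤) =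
  -- Both inequalities survive when s grows and t shrinks, so one pair S, T serves both.
  let (S , s≤S , s′≤S , LS) = L-max x Ls Ls′
      (T , T≤t , T≤t′ , UT) = U-min x Ut Ut′
      0<S = <-≤-trans 0<s s≤S
      0≤S = <⇒≤ 0<S
      0≤T = <⇒≤ (<-trans 0<S (L<U x LS UT))
      0≤v*q = 0≤* 0≤v (<⇒≤ 0<q)
      first = raise N k m E 0≤v 0≤T 0≤S T≤t (<⇒≤ 0<s) s≤S v≤
      second = raise N′ k′ m′ N (<⇒≤ (0<* 0<q 0<q)) 0≤T 0≤S T≤t′ (<⇒≤ 0<s′) s′≤S
        (≤-trans (*-monoʳ-≤-nonNeg (t′ ^ k′) {{nonNegative (0≤^ k′ (≤-trans 0≤T T≤t′))}}
          (^-mono N′ (<⇒≤ (0<* 0<q 0<q)) (<⇒≤ q²<v′))) v′≤)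
  in below (m ℕ.* E ℕ.+ m′ ℕ.* N) (k ℕ.* E ℕ.+ k′ ℕ.* N) (ℕ.pred (N ℕ.* E)) S T (v * q)
       (subst (L e) (sym (frac-half m k n m′ k′ n′)) (le Lb Lc)) 0<S LS UT
       0≤v*q (*-monoˡ-<-pos q {{positive 0<q}} p<v)
       (subst₂ _≤_ (split T) (sym (^-homo-* S (m ℕ.* E) (m′ ℕ.* N)))
         (*-mono-≤² (0≤* (0≤^ (N′ ℕ.* N) (<⇒≤ (0<* 0<q 0<q))) (0≤^ (k′ ℕ.* N) 0≤T)) (0≤^ (m ℕ.* E) 0≤S)
           first second))
  where
  N = suc n
  N′ = suc n′
  E = N′ ℕ.* 2
  raise : ∀ {u T S t s} N k m e → 0ℚ ≤ u → 0ℚ ≤ T → 0ℚ ≤ S → T ≤ t → 0ℚ ≤ s → s ≤ S →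
    u ^ N * t ^ k ≤ s ^ m → u ^ (N ℕ.* e) * T ^ (k ℕ.* e) ≤ S ^ (m ℕ.* e)
  raise {u} {T} {S} N k m e 0≤u 0≤T 0≤S T≤t 0≤s s≤S le = subst₂ _≤_
    (trans (^-distrib-* (u ^ N) (T ^ k) e) (cong₂ _*_ (^-assocʳ u N e) (^-assocʳ T k e)))
    (^-assocʳ S m e)
    (^-mono e (0≤* (0≤^ N 0≤u) (0≤^ k 0≤T))
      (≤-trans (*-mono-≤ˡ (u ^ N) (0≤^ N 0≤u) (^-mono k 0≤T T≤t)) (≤-trans le (^-mono m 0≤s s≤S))))
  exponent : N ℕ.* E ≡ N′ ℕ.* N ℕ.+ N′ ℕ.* N
  exponent = ℕ-solve 2 (λ n n′ → n ℕ:* (n′ ℕ:* ℕcon 2) ℕ:= n′ ℕ:* n ℕ:+ n′ ℕ:* n) refl N N′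
  split : ∀ T → (v ^ (N ℕ.* E) * T ^ (k ℕ.* E)) * ((q * q) ^ (N′ ℕ.* N) * T ^ (k′ ℕ.* N))
              ≡ (v * q) ^ (N ℕ.* E) * T ^ (k ℕ.* E ℕ.+ k′ ℕ.* N)
  split T = begin
    (v ^ (N ℕ.* E) * T₁) * ((q * q) ^ (N′ ℕ.* N) * T₂)
      ≡⟨ cong (λ z → (v ^ (N ℕ.* E) * T₁) * (z * T₂)) (trans (^-distrib-* q q (N′ ℕ.* N))
           (trans (sym (^-homo-* q (N′ ℕ.* N) (N′ ℕ.* N))) (cong (q ^_) (sym exponent)))) ⟩
    (v ^ (N ℕ.* E) * T₁) * (q ^ (N ℕ.* E) * T₂)
      ≡⟨ solve 4 (λ a b c d → (a :* b) :* (c :* d) := (a :* c) :* (b :* d)) refl (v ^ (N ℕ.* E)) T₁ (q ^ (N ℕ.* E)) T₂ ⟩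
    (v ^ (N ℕ.* E) * q ^ (N ℕ.* E)) * (T₁ * T₂)
      ≡⟨ cong₂ _*_ (sym (^-distrib-* v q (N ℕ.* E))) (sym (^-homo-* T (k ℕ.* E) (k′ ℕ.* N))) ⟩
    (v * q) ^ (N ℕ.* E) * T ^ (k ℕ.* E ℕ.+ k′ ℕ.* N) ∎
    where
    open ≡-Reasoning
    T₁ = T ^ (k ℕ.* E)
    T₂ = T ^ (k′ ℕ.* N)

-- Any p′ strictly between max(z / q, 0) and p will do.
split-< : ∀ {z p q} → z < p * q → 0ℚ < p → 0ℚ < q →
  ∃[ p′ ] (0ℚ < p′ × p′ < p × z < p′ * q)
split-< {z} {p} {q} z<pq 0<p 0<q = bound-below (<-dense (⊔-lub-< z/q<p 0<p))
  where
  instance _ = >-nonZero 0<q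
  z/q = z * 1/ q
  z/q*q : z/q * q ≡ z
  z/q*q = trans (*-assoc z (1/ q) q) (trans (cong (z *_) (*-inverseˡ q)) (*-identityʳ z))
  z/q<p : z/q < p
  z/q<p = *-cancel-< q 0<q (subst (_< p * q) (sym z/q*q) z<pq)
  ⊔-lub-< : ∀ {a b c} → a < c → b < c → a ⊔ b < c
  ⊔-lub-< {a} {b} {c} a<c b<c with ⊔-sel a b
  ... | inj₁ eq = subst (_< c) (sym eq) a<c
  ... | inj₂ eq = subst (_< c) (sym eq) b<c
  bound-below : ∃[ r ] (z/q ⊔ 0ℚ < r × r < p) → ∃[ p′ ] (0ℚ < p′ × p′ < p × z < p′ * q)
  bound-below (r , lt , r<p) = r , ≤-<-trans (p≤q⊔p z/q 0ℚ) lt , r<p ,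
    subst (_< r * q) z/q*q (*-monoˡ-<-pos q {{positive 0<q}} (≤-<-trans (p≤p⊔q z/q 0ℚ) lt))

-- The hypotheses give lower-cut membership only strictly below p and q². Both factors are therefore
-- shrunk slightly, keeping their product above z.
product-≤-power : ∀ {J} (1≤J : 1ᴿ ≤ᴿ J) {b c e p q} →
  (∀ {r₁ r₂} → L b r₁ → L c r₂ → L e (r₁ + ½ * r₂)) → 0ℚ < p → 0ℚ < q →
  fromℚ p ≤ᴿ J ^⟨ 1≤J ⟩ b → fromℚ (q * q) ≤ᴿ J ^⟨ 1≤J ⟩ c → fromℚ (p * q) ≤ᴿ J ^⟨ 1≤J ⟩ e
product-≤-power 1≤J {e = e} {p} {q} le 0<p 0<q p≤ q²≤ z z<pq =
  let (p′ , 0<p′ , p′<p , z<p′q) = split-< z<pq 0<p 0<q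
      (q′ , 0<q′ , q′<q , z<q′p′) = split-< (subst (z <_) (*-comm p′ q) z<p′q) 0<q 0<p′
  in L-closed (_ ^⟨ 1≤J ⟩ e) (subst (z <_) (*-comm q′ p′) z<q′p′)
       (power-product le 0<p′ 0<q′ (p≤ p′ p′<p) (q²≤ (q′ * q′) (≤-<-trans
         (*-mono-≤ˡ q′ (<⇒≤ 0<q′) (<⇒≤ q′<q)) (*-monoˡ-<-pos q {{positive 0<q}} q′<q))))

-- Since min(b, c) ≤ c, the exponent b + c - min(b, c) / 2 is at least b + c / 2.
half-min : ∀ {b c r₁ r₂} → L b r₁ → L c r₂ →
  L ((b +ᴿ c) -ᴿ (½ᴿ *ᴿ min b c)) (r₁ + ½ * r₂)
half-min {b} {c} {r₁} {r₂} L₁ L₂ =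
  let (r , r₂<r , Lr) = L-open c L₂
      -- Enclosing c with l ≥ r and u - l < r - r₂ yields u / 2 < l - r₂ / 2, which leaves room for
      -- an upper bound w of min(b, c) / 2.
      (l , u , Ll , Uu , r≤l , _ , u<) = approxIn c (r - r₂) (0<- r₂<r) Lr (proj₂ (U-inhabited c))
      (r₁′ , r₁<r₁′ , L₁′) = L-open b L₁
      (w , u/2<w , w<) = <-dense (half-< {l} {u} {r} u< r≤l)
  in r₁ + l , - w , (r₁′ , l , L₁′ , Ll , +-monoˡ-< l r₁<r₁′)
     , subst (U (½ᴿ *ᴿ min b c)) (solve 1 (λ w → w := :- (:- w)) refl w) (upper Uu u/2<w)
     , <-by (l - ½ * r₂ - w) (0<- w<) (solve 4 (λ a l w r → a :+ l :+ :- w :=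
         a :+ con ½ :* r :+ (l :- con ½ :* r :- w)) refl r₁ l w r₂)
  where
  half-< : ∀ {l u r} → u < l + (r - r₂) → r ≤ l → ½ * u < l - ½ * r₂
  half-< {l} {u} {r} u< r≤l = <-by (½ * (l + (r - r₂) - u) + ½ * (l - r))
    (0<+≤ (0<* (positive⁻¹ ½) (0<- u<)) (0≤* (nonNegative⁻¹ ½) (0≤- r≤l)))
    (solve 4 (λ l u r r₂ → l :- con ½ :* r₂ := con ½ :* u :+
      (con ½ :* (l :+ (r :- r₂) :- u) :+ con ½ :* (l :- r))) refl l u r r₂)
  upper : ∀ {u w} → U c u → ½ * u < w → U (½ᴿ *ᴿ min b c) w
  upper {u} {w} Uu lt = let (z , u/2<z , z<w) = <-dense lt in
    [ (λ Lz → ⊥-elim (<-asym u/2<z (lower Uu Lz))) , id ]′ (located (½ᴿ *ᴿ min b c) z<w)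
    where
    lower : ∀ {u z} → U c u → L (½ᴿ *ᴿ min b c) z → z < ½ * u
    lower Uu (a , a′ , d , d′ , a<½ , ½<a′ , (Lbd , Lcd) , Ud′ , z<lo) = <-≤-trans z<lo
      (≤-trans (Products.lo≤ (<⇒≤ a<½) (<⇒≤ ½<a′) ≤-refl (<⇒≤ (L<U (min b c) (Lbd , Lcd) Ud′)))
        (*-mono-≤ˡ ½ (nonNegative⁻¹ ½) (<⇒≤ (L<U c Lcd Uu))))

-- Counting

lookup-injective : ∀ {a} {X : Set a} {xs : List X} → Unique xs →
  ∀ {i j} → lookup xs i ≡ lookup xs j → i ≡ j
lookup-injective (_ ∷ _)  {zero}  {zero}  _  = refl
lookup-injective (x∉ ∷ _) {zero}  {suc j} eq = ⊥-elim (All.lookup x∉ (∈-lookup j) eq)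
lookup-injective (x∉ ∷ _) {suc i} {zero}  eq = ⊥-elim (All.lookup x∉ (∈-lookup i) (sym eq))
lookup-injective (_ ∷ u)  {suc i} {suc j} eq = cong suc (lookup-injective u eq)

-- Pigeonhole principle. The code may depend on the membership proof, because it is read off the
-- torsion point found there; injectivity across all proofs makes every choice of point safe.
length≤codes : ∀ {X : Set} (P : X → Set) {n} (code : ∀ x → P x → Fin n) →
  (∀ x y (p : P x) (q : P y) → code x p ≡ code y q → x ≡ y) →
  ∀ xs → Unique xs → All P xs → length xs ℕ.≤ n
length≤codes P code code-injective xs unique all =
  injective⇒≤ {f = λ i → code (lookup xs i) (All.lookup all (∈-lookup {xs = xs} i))}
    (λ {i} {j} eq → lookup-injective unique (code-injective (lookup xs i) (lookup xs j) _ _ eq))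

-- Residues replace offsets from the start of a window: elements at pairwise distance below n are
-- told apart by them, and no real endpoint has to be rounded.
mod-injective : ∀ n .{{_ : ℕ.NonZero n}} {a b} → ℕ.∣ a - b ∣ ℕ.< n → a mod n ≡ b mod n → a ≡ b
mod-injective n {a} {b} lt eq = ℕₚ.∣m-n∣≡0⇒m≡n (multiple≡0 ℕ.∣ a ℕ./ n - b ℕ./ n ∣ distance)
  where
  a%n≡b%n : a % n ≡ b % n
  a%n≡b%n = trans (sym (toℕ-fromℕ< (m%n<n a n))) (trans (cong toℕ eq) (toℕ-fromℕ< (m%n<n b n)))
  distance : ℕ.∣ a - b ∣ ≡ ℕ.∣ a ℕ./ n - b ℕ./ n ∣ ℕ.* n
  distance = begin
    ℕ.∣ a - b ∣
      ≡⟨ cong₂ ℕ.∣_-_∣ (m≡m%n+[m/n]*n a n) (m≡m%n+[m/n]*n b n) ⟩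
    ℕ.∣ a % n ℕ.+ a ℕ./ n ℕ.* n - b % n ℕ.+ b ℕ./ n ℕ.* n ∣
      ≡⟨ cong (λ r → ℕ.∣ r ℕ.+ a ℕ./ n ℕ.* n - b % n ℕ.+ b ℕ./ n ℕ.* n ∣) a%n≡b%n ⟩
    ℕ.∣ b % n ℕ.+ a ℕ./ n ℕ.* n - b % n ℕ.+ b ℕ./ n ℕ.* n ∣
      ≡⟨ ℕₚ.∣m+n-m+o∣≡∣n-o∣ (b % n) _ _ ⟩
    ℕ.∣ a ℕ./ n ℕ.* n - b ℕ./ n ℕ.* n ∣
      ≡⟨ sym (ℕₚ.*-distribʳ-∣-∣ n (a ℕ./ n) (b ℕ./ n)) ⟩
    ℕ.∣ a ℕ./ n - b ℕ./ n ∣ ℕ.* n ∎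
    where open ≡-Reasoning
  multiple≡0 : ∀ q → ℕ.∣ a - b ∣ ≡ q ℕ.* n → ℕ.∣ a - b ∣ ≡ 0
  multiple≡0 zero    d≡ = d≡
  multiple≡0 (suc q) d≡ = ⊥-elim (ℕₚ.<⇒≱ lt (subst (n ℕ.≤_) (sym d≡) (ℕₚ.m≤m+n n (q ℕ.* n))))

-- The recursion keeps n as long as n² reaches the next number. Otherwise n² = k, and (n + 1)² = k +
-- 1 + 2n ≤ 3(k + 1).
√-above : ∀ k .{{_ : ℕ.NonZero k}} → ∃[ n ] (k ℕ.≤ n ℕ.* n × n ℕ.* n ℕ.≤ 4 ℕ.* k)
√-above 1 = 1 , ℕₚ.≤-refl , ℕ.s≤s ℕ.z≤n
√-above (suc k@(suc _)) with √-above k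
... | n , k≤n² , n²≤4k with suc k ℕ.≤? n ℕ.* n
...   | yes k<n² = n , k<n² , ℕₚ.≤-trans n²≤4k (ℕₚ.*-monoʳ-≤ 4 (ℕₚ.n≤1+n k))
...   | no  k≮n² = suc n , next-above , next-below
  where
  n²≡k : n ℕ.* n ≡ k
  n²≡k = ℕₚ.≤-antisym (ℕₚ.≤-pred (ℕₚ.≰⇒> k≮n²)) k≤n²
  expand : suc n ℕ.* suc n ≡ suc (n ℕ.* n) ℕ.+ 2 ℕ.* n
  expand = ℕ-solve 1 (λ n → (ℕcon 1 ℕ:+ n) ℕ:* (ℕcon 1 ℕ:+ n) ℕ:= ℕcon 1 ℕ:+ n ℕ:* n ℕ:+ ℕcon 2 ℕ:* n) refl n
  n≤n² : ∀ n → n ℕ.≤ n ℕ.* n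
  n≤n² zero = ℕ.z≤n
  n≤n² (suc n) = ℕₚ.m≤m+n (suc n) (n ℕ.* suc n)
  next-above : suc k ℕ.≤ suc n ℕ.* suc n
  next-above = subst₂ ℕ._≤_ (cong suc n²≡k) (sym expand) (ℕₚ.m≤m+n (suc (n ℕ.* n)) (2 ℕ.* n))
  next-below : suc n ℕ.* suc n ℕ.≤ 4 ℕ.* suc k
  next-below = begin
    suc n ℕ.* suc n                    ≡⟨ expand ⟩
    suc (n ℕ.* n) ℕ.+ 2 ℕ.* n          ≤⟨ ℕₚ.+-monoʳ-≤ (suc (n ℕ.* n)) (ℕₚ.*-monoʳ-≤ 2 (ℕₚ.m≤n⇒m≤1+n (n≤n² n))) ⟩
    3 ℕ.* suc (n ℕ.* n)                ≡⟨ cong (λ z → 3 ℕ.* suc z) n²≡k ⟩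
    3 ℕ.* suc k                        ≤⟨ ℕₚ.*-monoˡ-≤ (suc k) (ℕₚ.n≤1+n 3) ⟩
    4 ℕ.* suc k                        ∎
    where open ℕₚ.≤-Reasoning

signCode : ℤ → Fin 2
signCode (ℤ.+ _)  = zero
signCode -[1+ _ ] = suc zero

abs-injective : ∀ {i j} → signCode i ≡ signCode j → ℤ.∣ i ∣ ≡ ℤ.∣ j ∣ → i ≡ j
abs-injective {ℤ.+ _}      {ℤ.+ _}      _ refl = refl
abs-injective { -[1+ _ ] } { -[1+ _ ] } _ refl = refl

∣m⊖n∣≡∣m-n∣ : ∀ m n → ℤ.∣ m ⊖ n ∣ ≡ ℕ.∣ m - n ∣
∣m⊖n∣≡∣m-n∣ m n with ℕₚ.≤-total m n
... | inj₁ m≤n = trans (ℤₚ.∣⊖∣-≤ m≤n) (sym (ℕₚ.m≤n⇒∣m-n∣≡n∸m m≤n))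
... | inj₂ n≤m = trans (cong ℤ.∣_∣ (ℤₚ.⊖-≥ n≤m)) (sym (ℕₚ.m≤n⇒∣n-m∣≡n∸m n≤m))

abs-difference : ∀ {i j} → signCode i ≡ signCode j → ℤ.∣ i ℤ.- j ∣ ≡ ℕ.∣ ℤ.∣ i ∣ - ℤ.∣ j ∣ ∣
abs-difference {ℤ.+ m}      {ℤ.+ n}      _ = trans (cong ℤ.∣_∣ (ℤₚ.m-n≡m⊖n m n)) (∣m⊖n∣≡∣m-n∣ m n)
abs-difference { -[1+ m ] } { -[1+ n ] } _ = trans (∣m⊖n∣≡∣m-n∣ (suc n) (suc m)) (ℕₚ.∣-∣-comm n m)

ι-∸ : ∀ {m n} → n ℕ.≤ m → ι (m ℕ.∸ n) ≡ ι m - ι n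
ι-∸ {m} {n} n≤m = trans (cong (_/ 1) (sym (ℤₚ.⊖-≥ n≤m))) (ι-⊖ m n)

distance-≤ : ∀ {M N a a′} → M ≤ᴿ fromℕ a → fromℕ a ≤ᴿ M +ᴿ N → M ≤ᴿ fromℕ a′ → fromℕ a′ ≤ᴿ M +ᴿ N →
  fromℕ ℕ.∣ a - a′ ∣ ≤ᴿ N
distance-≤ {M} {N} {a} {a′} M≤a a≤M+N M≤a′ a′≤M+N with ℕₚ.≤-total a a′
... | inj₁ a≤a′ = subst (λ q → fromℚ q ≤ᴿ N) (sym (trans (cong ι (ℕₚ.m≤n⇒∣m-n∣≡n∸m a≤a′)) (ι-∸ a≤a′)))
  (difference-≤ {M} {N} {ι a′} {ι a} M≤a a′≤M+N)
... | inj₂ a′≤a = subst (λ q → fromℚ q ≤ᴿ N) (sym (trans (cong ι (ℕₚ.m≤n⇒∣n-m∣≡n∸m a′≤a)) (ι-∸ a′≤a)))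
  (difference-≤ {M} {N} {ι a} {ι a′} M≤a′ a≤M+N)

shape : ∀ A B → ∃[ P ] (3-Torsion {A / 1} {B / 1} P × P ≢ 𝒪) → Shape A B
shape A B (P , 3P≡𝒪 , P≢𝒪) = HasFlex⇒Shape (integral-flex {A} {B} (3-torsion⇒flex P 3P≡𝒪 P≢𝒪))

module _ {M₁ N₁ M₂ N₂ : ℝ} {n₁ n₂ : ℕ} {{_ : ℕ.NonZero n₁}} {{_ : ℕ.NonZero n₂}}
  (N₁-bound : ∀ d → fromℕ d ≤ᴿ N₁ → d ℕ.< n₁)
  (N₂-bound : ∀ d → fromℕ (d ℕ.* d) ≤ᴿ N₂ → d ℕ.< n₂) where

  -- The factor 8 counts the sign of A, the sign of B and the kind of flex. The modulus n₂ need only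
  -- exceed the square root of N₂, because labels are separated quadratically.
  code : ∀ AB → S M₁ N₁ M₂ N₂ AB → Fin (n₁ ℕ.* (n₂ ℕ.* 8))
  code (A , B) (_ , _ , _ , P) = combine (ℤ.∣ A ∣ mod n₁) (combine (label (shape A B P) mod n₂)
    (combine (signCode A) (combine (signCode B) (kind (shape A B P)))))

  -- A is decoded first, from its sign and the residue of |A|. Then both curves have the same A, so
  -- the squared distance of the labels is at most |B - B′| ≤ N₂. Hence the labels agree, and with A
  -- and the kind they determine B.
  code-injective : ∀ AB AB′ (s : S M₁ N₁ M₂ N₂ AB) (s′ : S M₁ N₁ M₂ N₂ AB′) →
    code AB s ≡ code AB′ s′ → AB ≡ AB′
  code-injective (A , B) (A′ , B′) ((M₁≤A , A≤) , (M₂≤B , B≤) , _ , P)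
                                   ((M₁≤A′ , A′≤) , (M₂≤B′ , B′≤) , _ , P′) eq =
    let (A-mod , eq₁)     = combine-injective _ _ _ _ eq
        (label-mod , eq₂) = combine-injective _ _ _ _ eq₁
        (A-sign , eq₃)    = combine-injective (signCode A) _ _ _ eq₂
        (B-sign , k≡)     = combine-injective (signCode B) _ _ _ eq₃
        A≡A′ = abs-injective A-sign (mod-injective n₁
          (N₁-bound ℕ.∣ ℤ.∣ A ∣ - ℤ.∣ A′ ∣ ∣ (distance-≤ {M₁} {N₁} {ℤ.∣ A ∣} {ℤ.∣ A′ ∣} M₁≤A A≤ M₁≤A′ A′≤)) A-mod)
    in cong₂ _,_ A≡A′ (same-B A≡A′ (shape A B P) (shape A′ B′ P′) k≡ B-sign label-mod)
    where
    same-B : A ≡ A′ → (p : Shape A B) (p′ : Shape A′ B′) → kind p ≡ kind p′ →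
      signCode B ≡ signCode B′ → label p mod n₂ ≡ label p′ mod n₂ → B ≡ B′
    same-B refl p p′ k≡ B-sign label-mod = determined p p′ k≡
      (mod-injective n₂ (N₂-bound d (≤ᴿ-weaken {ι (d ℕ.* d)} {ι D} {N₂}
        (ι-mono {d ℕ.* d} {D} (subst (d ℕ.* d ℕ.≤_) (abs-difference B-sign) (separated p p′ k≡)))
        (distance-≤ {M₂} {N₂} {ℤ.∣ B ∣} {ℤ.∣ B′ ∣} M₂≤B B≤ M₂≤B′ B′≤))) label-mod)
      where
      d = ℕ.∣ label p - label p′ ∣
      D = ℕ.∣ ℤ.∣ B ∣ - ℤ.∣ B′ ∣ ∣

  length≤ : ∀ xs → Unique xs → All (S M₁ N₁ M₂ N₂) xs → length xs ℕ.≤ n₁ ℕ.* (n₂ ℕ.* 8)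
  length≤ = length≤codes (S M₁ N₁ M₂ N₂) code code-injective

-- The common estimate and the two windows

¼ : ℚ
¼ = ℤ.+ 1 / 4

-- The exponent e stands for any bound on b + c / 2. With n₁ ≤ 3Jᵇ and n₂² ≤ 16Jᶜ there are at most
-- 8n₁n₂ codes, and 96 = 8 · 3 · 4.
#S≤ : ∀ {J} (1≤J : 1ᴿ ≤ᴿ J) M₁ M₂ b c e → L b 0ℚ → L c 0ℚ →
  (∀ {r₁ r₂} → L b r₁ → L c r₂ → L e (r₁ + ½ * r₂)) →
  # S M₁ (J ^⟨ 1≤J ⟩ b) M₂ (J ^⟨ 1≤J ⟩ c) ≤ fromℕ 96 *ᴿ J ^⟨ 1≤J ⟩ e
#S≤ {J} 1≤J M₁ M₂ b c e 0<b 0<c exponent xs unique all =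
  let (n₁ , above₁ , n₁≤) = ℕ-above {J ^⟨ 1≤J ⟩ b} 1≤Jᵇ
      (k , above₂ , k≤)  = ℕ-above {J ^⟨ 1≤J ⟩ c} 1≤Jᶜ
      (n₂ , k≤n₂² , n₂²≤4k) = √-above k {{ℕ.>-nonZero (ℕₚ.<⇒≤ (above₂ 1 1≤Jᶜ))}}
  in bound n₁ k n₂ above₁ n₁≤ above₂ k≤ k≤n₂² n₂²≤4k
  where
  1≤Jᵇ = 1≤power {J} 1≤J {b} 0<b
  1≤Jᶜ = 1≤power {J} 1≤J {c} 0<c
  0<ι′ : ∀ {n} → 0 ℕ.< n → 0ℚ < ι n
  0<ι′ {suc n} _ = 0<ι n
  scaled : ∀ n₁ n₂ → ι (n₁ ℕ.* (n₂ ℕ.* 8)) ≡ ι 96 * (ι n₁ * ⅓ * (ι n₂ * ¼))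
  scaled n₁ n₂ = trans (ι-* n₁ (n₂ ℕ.* 8)) (trans (cong (ι n₁ *_) (ι-* n₂ 8))
    (solve 2 (λ a b → a :* (b :* con (ι 8)) := con (ι 96) :* (a :* con ⅓ :* (b :* con ¼))) refl (ι n₁) (ι n₂)))
  -- From n² ≤ 4k follows (n / 4)² ≤ k / 4 ≤ k / 3, so n / 4 can play the role of the square root of
  -- Jᶜ.
  square : ∀ k n → n ℕ.* n ℕ.≤ 4 ℕ.* k → ι n * ¼ * (ι n * ¼) ≤ ι k * ⅓
  square k n n²≤4k = begin
    ι n * ¼ * (ι n * ¼)      ≡⟨ solve 1 (λ n → n :* con ¼ :* (n :* con ¼) := con (¼ * ¼) :* (n :* n)) refl (ι n) ⟩
    ¼ * ¼ * (ι n * ι n)      ≡⟨ cong (¼ * ¼ *_) (sym (ι-* n n)) ⟩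
    ¼ * ¼ * ι (n ℕ.* n)      ≤⟨ *-mono-≤ˡ (¼ * ¼) (nonNegative⁻¹ (¼ * ¼)) (ι-mono {n ℕ.* n} {4 ℕ.* k} n²≤4k) ⟩
    ¼ * ¼ * ι (4 ℕ.* k)      ≡⟨ cong (¼ * ¼ *_) (ι-* 4 k) ⟩
    ¼ * ¼ * (ι 4 * ι k)      ≤⟨ ≤-by (ι k * (ℤ.+ 1 / 12)) (0≤* (0≤ι k) (nonNegative⁻¹ (ℤ.+ 1 / 12)))
                                  (solve 1 (λ k → k :* con ⅓ := con (¼ * ¼) :* (con (ι 4) :* k) :+ k :* con (ℤ.+ 1 / 12)) refl (ι k)) ⟩
    ι k * ⅓                  ∎
    where open ≤-Reasoning
  bound : ∀ n₁ k n₂ → (∀ d → fromℕ d ≤ᴿ J ^⟨ 1≤J ⟩ b → d ℕ.< n₁) → fromℚ (ι n₁ * ⅓) ≤ᴿ J ^⟨ 1≤J ⟩ b →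
    (∀ d → fromℕ d ≤ᴿ J ^⟨ 1≤J ⟩ c → d ℕ.< k) → fromℚ (ι k * ⅓) ≤ᴿ J ^⟨ 1≤J ⟩ c →
    k ℕ.≤ n₂ ℕ.* n₂ → n₂ ℕ.* n₂ ℕ.≤ 4 ℕ.* k → fromℕ (length xs) ≤ᴿ fromℕ 96 *ᴿ J ^⟨ 1≤J ⟩ e
  bound n₁ k n₂ above₁ n₁≤ above₂ k≤ k≤n₂² n₂²≤4k =
    ≤ᴿ-weaken {ι (length xs)} {ι 96 * (p * q)} {fromℕ 96 *ᴿ J ^⟨ 1≤J ⟩ e}
      (≤-trans (ι-mono {length xs} {n₁ ℕ.* (n₂ ℕ.* 8)} (length≤ {M₁} {J ^⟨ 1≤J ⟩ b} {M₂} {J ^⟨ 1≤J ⟩ c}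
          {{ℕ.>-nonZero 0<n₁}} {{ℕ.>-nonZero 0<n₂}} above₁ above₂² xs unique all))
        (≤-reflexive (scaled n₁ n₂)))
      (scale-≤ {ι 96} {p * q} {J ^⟨ 1≤J ⟩ e} (0<ι 95)
        (product-≤-power {J} 1≤J {b} {c} {e} {p} {q} exponent
          (0<* (0<ι′ 0<n₁) (positive⁻¹ ⅓)) (0<* (0<ι′ 0<n₂) (positive⁻¹ ¼)) n₁≤
          (≤ᴿ-weaken {q * q} {ι k * ⅓} {J ^⟨ 1≤J ⟩ c} (square k n₂ n₂²≤4k) k≤)))
    where
    p = ι n₁ * ⅓
    q = ι n₂ * ¼
    above₂² : ∀ d → fromℕ (d ℕ.* d) ≤ᴿ J ^⟨ 1≤J ⟩ c → d ℕ.< n₂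
    above₂² d d²≤ = ℕₚ.≰⇒> λ n₂≤d →
      ℕₚ.<⇒≱ (above₂ (d ℕ.* d) d²≤) (ℕₚ.≤-trans k≤n₂² (ℕₚ.*-mono-≤ n₂≤d n₂≤d))
    0<n₁ = ℕₚ.≤-<-trans ℕ.z≤n (above₁ 1 1≤Jᵇ)
    0<n₂ = ℕₚ.≤-<-trans ℕ.z≤n (above₂² 1 1≤Jᶜ)

0<ᴿ96 : 0ᴿ <ᴿ fromℕ 96
0<ᴿ96 = 1ℚ , 0<1 , from-yes (1ℚ <? ι 96)

0<ᴿ⇒L0 : ∀ {b} → 0ᴿ <ᴿ b → L b 0ℚ
0<ᴿ⇒L0 {b} (_ , 0<q , Lq) = L-closed b 0<q Lq

2+3/2≤4 : ∀ {r₁ r₂} → r₁ < ι 2 → r₂ < ι 3 → r₁ + ½ * r₂ < ι 4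
2+3/2≤4 {r₁} {r₂} r₁<2 r₂<3 = <-by (ι 2 - r₁ + ½ * (ι 3 - r₂) + ½)
  (0<+ (0<+ (0<- r₁<2) (0<* (positive⁻¹ ½) (0<- r₂<3))) (positive⁻¹ ½))
  (solve 2 (λ r s → con (ι 4) := (r :+ con ½ :* s) :+ (con (ι 2) :- r :+ con ½ :* (con (ι 3) :- s) :+ con ½)) refl r₁ r₂)

corollary7p2 : (∃[ C ] (0ᴿ <ᴿ C × (∃[ J₀ ] ((J : ℝ) (1≤J : 1ᴿ ≤ᴿ J) → J₀ ≤ᴿ J →
    # S 0ᴿ (J ^⟨ 1≤J ⟩ 2ᴿ) 0ᴿ (J ^⟨ 1≤J ⟩ 3ᴿ) ≤ C *ᴿ J ^⟨ 1≤J ⟩ 4ᴿ))))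
    ×
    ((b c : ℝ) → 0ᴿ <ᴿ b → b <ᴿ 2ᴿ → 0ᴿ <ᴿ c → c <ᴿ 3ᴿ →
    ∃[ C ] (0ᴿ <ᴿ C × (∃[ J₀ ] ((J : ℝ) (1≤J : 1ᴿ ≤ᴿ J) → J₀ ≤ᴿ J →
    # S (J ^⟨ 1≤J ⟩ 2ᴿ -ᴿ J ^⟨ 1≤J ⟩ b) (J ^⟨ 1≤J ⟩ b)
    (J ^⟨ 1≤J ⟩ 3ᴿ -ᴿ J ^⟨ 1≤J ⟩ c) (J ^⟨ 1≤J ⟩ c)
    ≤ C *ᴿ J ^⟨ 1≤J ⟩ ((b +ᴿ c) -ᴿ (½ᴿ *ᴿ min b c))))))
corollary7p2 =
  -- The threshold is 1 because the estimate holds for every J ≥ 1. In the first window b = 2 and c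
  -- = 3, and 2 + 3/2 ≤ 4.
  (fromℕ 96 , 0<ᴿ96 , 1ᴿ , λ J 1≤J _ → #S≤ {J} 1≤J 0ᴿ 0ᴿ 2ᴿ 3ᴿ 4ᴿ (0<ι 1) (0<ι 2) 2+3/2≤4) ,
  λ b c 0<b _ 0<c _ → fromℕ 96 , 0<ᴿ96 , 1ᴿ , λ J 1≤J _ →
    #S≤ {J} 1≤J (J ^⟨ 1≤J ⟩ 2ᴿ -ᴿ J ^⟨ 1≤J ⟩ b) (J ^⟨ 1≤J ⟩ 3ᴿ -ᴿ J ^⟨ 1≤J ⟩ c) b c
      ((b +ᴿ c) -ᴿ (½ᴿ *ᴿ min b c)) (0<ᴿ⇒L0 {b} 0<b) (0<ᴿ⇒L0 {c} 0<c) (half-min {b} {c})
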